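{- Let $\alpha_p$ denote the best known approximation ratio of a polynomial-time algorithm for min-cardinality $p$-ECSS. For every fixed constant $k\ge 1$, there is a polynomial-time algorithm for min-cardinality $k$-tier FGC that, on every feasible instance with tier requirements $1\le q_1\le q_2\le\cdots\le q_k$, returns a feasible solution of cardinality at most $$\alpha_{q_1}+\frac{2(q_k-q_1)}{q_1}$$ times the minimum cardinality of a feasible solution.
   Context: Min-cardinality $p$-ECSS: given an undirected graph $G=(V,E)$, find a minimum-cardinality $F\subseteq E$ such that $(V,F)$ is $p$-edge-connected, i.e. $|\delta(R)\cap F|\ge p$ for every $\emptyset\ne R\subsetneq V$, where $\delta(R)$ is the set of edges of $G$ with exactly one end vertex in $R$. The number $\alpha_p$ enters only as the guarantee of some given polynomial-time $\alpha_p$-approximation algorithm for this problem. Min-cardinality $k$-tier FGC. Input: an undirected graph $G=(V,E)$, a nested family of edge-tiers $\mathcal{T}=(T_1,\ldots,T_k)$ with $T_1\subseteq\cdots\subseteq T_k=E$, and integers $\mathcal{Q}=(q_1,\ldots,q_k)$ with $0\le q_1\le\cdots\le q_k$. A cut $\emptyset\ne R\subsetneq V$ is $(\mathcal{T},\mathcal{Q})$-safe in $(V,F)$, $F\subseteq E$, if there exists $i\in\{1,\ldots,k\}$ with $|\delta(R)\cap F\cap T_i|\ge q_i$. The graph $(V,F)$ is $(\mathcal{T},\mathcal{Q})$-FGC if every cut $\emptyset\ne R\subsetneq V$ is $(\mathcal{T},\mathcal{Q})$-safe in $(V,F)$; then $F$ is called a feasible solution. Goal: find a feasible solution $F$ minimizing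 $|F|$. The instance is feasible if $(V,E)$ is $(\mathcal{T},\mathcal{Q})$-FGC. -}

module Defs where

open import Data.Bool using (Bool; true; false; _xor_)
open import Data.Fin using (Fin; zero; suc; toℕ)
import Data.Fin as Fin
open import Data.Fin.Subset using (Subset; _⊆_; _⊂_; _∩_; ⊤; ∣_∣; Nonempty)
import Data.Integer as ℤ
open import Data.List using (List; []; _∷_; map)
open import Data.Nat using (ℕ; zero; suc; _+_; _*_; _^_; _∸_; _≤_; _≥_; NonZero)
open import Data.Nat.Binary using (ℕᵇ; 2[1+_]; 1+[2_]; fromℕ)
import Data.Nat.Binary as ℕᵇ
open import Data.Product using (∃-syntax; _×_; _,_; proj₁; proj₂)
open import Data.Rational using (ℚ; _/_)
import Data.Rational as ℚ
import Data.Rational.Properties as ℚₚ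
open import Data.Sum using (_⊎_)
import Data.Unit as Unit
open import Data.Vec using (lookup; tabulate; toList)
open import Relation.Binary.PropositionalEquality using (_≡_; _≢_; sym; trans; cong; subst)

------------------------------------------------------------------------
-- Real numbers

-- A real x is represented by its open upper cut { r ∈ ℚ ∣ x < r }.
-- Classically these cuts are exactly the real numbers; locatedness, the
-- only further constructive requirement on Dedekind reals, is not assumed.

record ℝ : Set₁ where
  field
    upper     : ℚ → Set
    inhabited : ∃[ r ] upper r
    bounded   : ∃[ l ] (∀ {r} → upper r → l ℚ.< r)
    upward    : ∀ {r s} → r ℚ.< s → upper r → upper s
    open′     : ∀ {s} → upper s → ∃[ r ] (r ℚ.< s × upper r)

open ℝ public

private
  +-−-cancel : ∀ r s → (r ℚ.+ s) ℚ.- s ≡ r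
  +-−-cancel r s = trans (ℚₚ.+-assoc r s (ℚ.- s))
    (trans (cong (r ℚ.+_) (ℚₚ.+-inverseʳ s)) (ℚₚ.+-identityʳ r))

  −-+-cancel : ∀ r s → (r ℚ.- s) ℚ.+ s ≡ r
  −-+-cancel r s = trans (ℚₚ.+-assoc r (ℚ.- s) s)
    (trans (cong (r ℚ.+_) (ℚₚ.+-inverseˡ s)) (ℚₚ.+-identityʳ r))

infixl 6 _⊕_

_⊕_ : ℝ → ℚ → ℝ
upper     (x ⊕ s) r = upper x (r ℚ.- s)
inhabited (x ⊕ s) with inhabited x
... | r , x<r = r ℚ.+ s , subst (upper x) (sym (+-−-cancel r s)) x<r
bounded   (x ⊕ s) with bounded x
... | l , l<x = l ℚ.+ s , λ {r} x<r →
  subst (l ℚ.+ s ℚ.<_) (−-+-cancel r s) (ℚₚ.+-monoˡ-< s (l<x x<r))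
upward    (x ⊕ s) r<t = upward x (ℚₚ.+-monoˡ-< (ℚ.- s) r<t)
open′     (x ⊕ s) {t} x<t with open′ x x<t
... | r , r<t , x<r = r ℚ.+ s
  , subst (r ℚ.+ s ℚ.<_) (−-+-cancel t s) (ℚₚ.+-monoˡ-< s r<t)
  , subst (upper x) (sym (+-−-cancel r s)) x<r

-- a ≤ x · b, for natural numbers a, b and a real x.
infix 4 _≤_·_

_≤_·_ : ℕ → ℝ → ℕ → Set
a ≤ x · b = ∀ r → upper x r → (ℤ.+ a / 1) ℚ.≤ r ℚ.* (ℤ.+ b / 1)

------------------------------------------------------------------------
-- Algorithms and running time

-- Programs are those of Jones' language WHILE over binary trees, in
-- point-free form: the store is a single tree, and pairing and projections
-- take the place of variables.  Every primitive operation has unit cost.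
-- Since a step allocates at most one new cell (all other data being shared
-- by pointers), polynomial time in this model coincides with polynomial
-- time on Turing machines.

infixr 5 _∙_

data Tree : Set where
  nil : Tree
  _∙_ : Tree → Tree → Tree

size : Tree → ℕ
size nil     = 1
size (s ∙ t) = 1 + size s + size t

head tail : Tree → Tree
head nil     = nil
head (s ∙ _) = s
tail nil     = nil
tail (_ ∙ t) = t

infixr 4 _⨾_

data Program : Set where
  `id `nil `head `tail : Program
  _⨾_                  : Program → Program → Program
  `pair                : Program → Program → Program
  `if                  : Program → Program → Program → Program
  `while               : Program → Program → Program

-- p ⊢ x ⇓ y [ t ]: on input x the program p halts with output y after t
-- steps.  In a test, nil is false and every other tree is true.

infix 3 _⊢_⇓_[_]

data _⊢_⇓_[_] : Program → Tree → Tree → ℕ → Set where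
  ⇓id    : ∀ {x} → `id ⊢ x ⇓ x [ 1 ]
  ⇓nil   : ∀ {x} → `nil ⊢ x ⇓ nil [ 1 ]
  ⇓head  : ∀ {x} → `head ⊢ x ⇓ head x [ 1 ]
  ⇓tail  : ∀ {x} → `tail ⊢ x ⇓ tail x [ 1 ]
  ⇓seq   : ∀ {p q x y z s t} →
           p ⊢ x ⇓ y [ s ] → q ⊢ y ⇓ z [ t ] →
           (p ⨾ q) ⊢ x ⇓ z [ 1 + s + t ]
  ⇓pair  : ∀ {p q x y z s t} →
           p ⊢ x ⇓ y [ s ] → q ⊢ x ⇓ z [ t ] →
           `pair p q ⊢ x ⇓ y ∙ z [ 1 + s + t ]
  ⇓then  : ∀ {b p q x u v y s t} →
           b ⊢ x ⇓ u ∙ v [ s ] → p ⊢ x ⇓ y [ t ] →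
           `if b p q ⊢ x ⇓ y [ 1 + s + t ]
  ⇓else  : ∀ {b p q x y s t} →
           b ⊢ x ⇓ nil [ s ] → q ⊢ x ⇓ y [ t ] →
           `if b p q ⊢ x ⇓ y [ 1 + s + t ]
  ⇓stop  : ∀ {b p x s} →
           b ⊢ x ⇓ nil [ s ] →
           `while b p ⊢ x ⇓ x [ 1 + s ]
  ⇓again : ∀ {b p x u v y z r s t} →
           b ⊢ x ⇓ u ∙ v [ r ] → p ⊢ x ⇓ y [ s ] → `while b p ⊢ y ⇓ z [ t ] →
           `while b p ⊢ x ⇓ z [ 1 + r + s + t ]

------------------------------------------------------------------------
-- Graphs

-- Vertices are Fin n, edges are Fin m.  The order of the two ends of an
-- edge carries no meaning.

record Graph : Set where
  field
    n    : ℕ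
    m    : ℕ
    ends : Fin m → Fin n × Fin n

  EdgeSet VertexSet : Set
  EdgeSet   = Subset m
  VertexSet = Subset n

  δ : VertexSet → EdgeSet
  δ R = tabulate λ e →
    lookup R (proj₁ (ends e)) xor lookup R (proj₂ (ends e))

  IsCut : VertexSet → Set
  IsCut R = Nonempty R × R ⊂ ⊤

  SameEnds : Fin m → Fin m → Set
  SameEnds e f with ends e | ends f
  ... | u , v | x , y = (u ≡ x × v ≡ y) ⊎ (u ≡ y × v ≡ x)

  IsSimple : Set
  IsSimple = (∀ e → proj₁ (ends e) ≢ proj₂ (ends e))
           × (∀ e f → SameEnds e f → e ≡ f)

-- The two usual meanings of "undirected graph"; in a multigraph, parallel
-- edges and loops are permitted.

data GraphKind : Set where
  simple multi : GraphKind

OfKind : GraphKind → Graph → Set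
OfKind simple G = Graph.IsSimple G
OfKind multi  _ = Unit.⊤

------------------------------------------------------------------------
-- Encoding of inputs and outputs

encodeList : List Tree → Tree
encodeList []       = nil
encodeList (t ∷ ts) = t ∙ encodeList ts

encodeBool : Bool → Tree
encodeBool false = nil
encodeBool true  = nil ∙ nil

-- Unary; used for vertices only, whose number is at most the size of an
-- explicit listing of V.
encodeUnary : ℕ → Tree
encodeUnary zero    = nil
encodeUnary (suc n) = nil ∙ encodeUnary n

encodeBinary : ℕᵇ → Tree
encodeBinary ℕᵇ.zero  = nil
encodeBinary 2[1+ x ] = encodeBool false ∙ encodeBinary x
encodeBinary 1+[2 x ] = encodeBool true ∙ encodeBinary x

encodeℕ : ℕ → Tree
encodeℕ a = encodeBinary (fromℕ a)

encodeSubset : ∀ {n} → Subset n → Tree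
encodeSubset p = encodeList (map encodeBool (toList p))

encodeFamily : ∀ {n} → (Fin n → Tree) → Tree
encodeFamily f = encodeList (toList (tabulate f))

encodeGraph : Graph → Tree
encodeGraph G = encodeUnary n ∙ encodeFamily λ e →
  encodeUnary (toℕ (proj₁ (ends e))) ∙ encodeUnary (toℕ (proj₂ (ends e)))
  where open Graph G

------------------------------------------------------------------------
-- Problems asking for a minimum-cardinality edge set of a graph

record Problem : Set₁ where
  field
    Instance : Set
    graph    : Instance → Graph
    Feasible : (I : Instance) → Graph.EdgeSet (graph I) → Set
    encode   : Instance → Tree

  FeasibleInstance : Instance → Set
  FeasibleInstance I = Feasible I ⊤

  IsMinimum : (I : Instance) → Graph.EdgeSet (graph I) → Set
  IsMinimum I F = Feasible I F × (∀ F′ → Feasible I F′ → ∣ F ∣ ≤ ∣ F′ ∣)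

  -- The time bound holds on all instances, feasible or not.
  PolynomialTime : Program → Set
  PolynomialTime A = ∃[ c ] ∃[ d ] ∀ I → ∃[ y ] ∃[ t ]
    (A ⊢ encode I ⇓ y [ t ]) × t ≤ c * size (encode I) ^ d

  ReturnsWithin : Program → Instance → ℝ → Set
  ReturnsWithin A I ρ = ∃[ F ] ∃[ t ]
    (A ⊢ encode I ⇓ encodeSubset F [ t ]) ×
    Feasible I F ×
    (∀ F* → IsMinimum I F* → ∣ F ∣ ≤ ρ · ∣ F* ∣)

------------------------------------------------------------------------
-- Min-cardinality p-ECSS

EdgeConnected : (G : Graph) → ℕ → Graph.EdgeSet G → Set
EdgeConnected G p F = ∀ R → IsCut R → ∣ δ R ∩ F ∣ ≥ p
  where open Graph G

record ECSSInstance (κ : GraphKind) : Set where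
  field
    G         : Graph
    kind      : OfKind κ G
    p         : ℕ
    .{{p≢0}}  : NonZero p

ECSS : GraphKind → Problem
ECSS κ = record
  { Instance = ECSSInstance κ
  ; graph    = G
  ; Feasible = λ I → EdgeConnected (G I) (p I)
  ; encode   = λ I → encodeGraph (G I) ∙ encodeℕ (p I)
  }
  where open ECSSInstance

------------------------------------------------------------------------
-- Min-cardinality k-tier FGC

firstTier lastTier : ∀ {k} .{{_ : NonZero k}} → Fin k
firstTier {suc k} = zero
lastTier  {suc k} = Fin.fromℕ k

record FGCInstance (κ : GraphKind) (k : ℕ) .{{_ : NonZero k}} : Set where
  field
    G        : Graph
    kind     : OfKind κ G
    T        : Fin k → Graph.EdgeSet G
    T-nested : ∀ {i j} → i Fin.≤ j → T i ⊆ T j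
    T-last   : T lastTier ≡ ⊤
    q        : Fin k → ℕ
    q-mono   : ∀ {i j} → i Fin.≤ j → q i ≤ q j

  open Graph G public using (EdgeSet; VertexSet; δ; IsCut)

  q₁ qₖ : ℕ
  q₁ = q firstTier
  qₖ = q lastTier

  Safe : EdgeSet → VertexSet → Set
  Safe F R = ∃[ i ] ∣ δ R ∩ F ∩ T i ∣ ≥ q i

  IsFGC : EdgeSet → Set
  IsFGC F = ∀ R → IsCut R → Safe F R

FGC : GraphKind → (k : ℕ) .{{_ : NonZero k}} → Problem
FGC κ k = record
  { Instance = FGCInstance κ k
  ; graph    = G
  ; Feasible = IsFGC
  ; encode   = λ I → encodeGraph (G I)
                   ∙ encodeFamily (λ i → encodeSubset (T I i))
                   ∙ encodeFamily (λ i → encodeℕ (q I i))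
  }
  where open FGCInstance

------------------------------------------------------------------------
-- Approximation algorithms

-- α is a function of p, and the algorithm receives p as part of its input.
ApproximatesECSS : GraphKind → (ℕ → ℝ) → Program → Set
ApproximatesECSS κ α A =
  PolynomialTime A ×
  (∀ I → FeasibleInstance I → ReturnsWithin A I (α (ECSSInstance.p I)))
  where open Problem (ECSS κ)

-- The ratio is a function of q₁ and qₖ.
ApproximatesFGC : GraphKind → (k : ℕ) .{{_ : NonZero k}} →
                  ((q₁ qₖ : ℕ) .{{_ : NonZero q₁}} → ℝ) → Program → Set
ApproximatesFGC κ k ρ B =
  PolynomialTime B ×
  (∀ I → .{{_ : NonZero (q₁ I)}} → FeasibleInstance I →
   ReturnsWithin B I (ρ (q₁ I) (qₖ I)))
  where
  open Problem (FGC κ k)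
  open FGCInstance using (q₁; qₖ)

module Submission where

-- Run the q₁-ECSS algorithm to get F₁, and then qₖ ∸ q₁ times add to the current
-- edge set F a maximal forest of the remaining edges.  Each forest contains an
-- edge of every cut that is not yet exhausted, so in the end |δ(R) ∩ F| ≥ qₖ or
-- δ(R) ⊆ F for every cut R; as Tₖ = E and the instance is feasible, R is safe
-- either way.  A feasible solution F* is q₁-edge-connected, so |F₁| ≤ α |F*|
-- and, by degree counting, q₁ (n − 1) ≤ 2 |F*|, while each forest has at most
-- n − 1 edges.  More than m rounds are useless, which keeps the number of rounds
-- polynomial although the q's are written in binary.
--
-- The forest is found by contraction: go through the edges, and whenever an
-- unmarked edge joins two components, mark it and merge them.

open import Data.Nat.Properties
open import Algebra.Properties.CommutativeMonoid.Sum +-0-commutativeMonoid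
  using (∑-distrib-+; sum-replicate-zero) renaming (sum to ∑)
open import Data.Bool using (Bool; true; false; if_then_else_; _xor_; _∧_)
open import Data.Bool.Properties using (∧-zeroʳ; ∧-identityʳ; xor-same)
open import Data.Fin using (Fin; zero; suc)
import Data.Fin as Fin
import Data.Fin.Properties as Finₚ
open import Data.Fin.Subset using (Subset; _∈_; _⊆_; _∩_; _-_; ⊤; ⁅_⁆; ∣_∣)
open import Data.Fin.Subset.Properties
import Data.Integer as ℤ
import Data.Integer.Properties as ℤₚ
open import Data.List using (List; []; _∷_; map; length; reverse; _ʳ++_) renaming (_++_ to _++ᴸ_)
open import Data.List.Properties
  using (∷-injective; ∷-injectiveˡ; ∷-injectiveʳ; map-cong; map-∘; length-map
        ; length-ʳ++; ʳ++-ʳ++; ++-identityʳ; map-ʳ++)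
open import Data.List.Relation.Binary.Permutation.Propositional.Properties using (↭-reverse; map⁺)
open import Data.Nat
  using (ℕ; zero; suc; NonZero; _+_; _*_; _∸_; _⊓_; _^_; _≡ᵇ_; _≤_; _<_
        ; z≤n; s≤s; _≤?_; _≟_; ≢-nonZero; >-nonZero⁻¹)
open import Data.Nat.Binary using (ℕᵇ; 2[1+_]; 1+[2_]; toℕ)
import Data.Nat.Binary as ℕᵇ
import Data.Nat.Binary.Properties as ℕᵇₚ
open import Data.Nat.ListAction using (sum)
open import Data.Nat.ListAction.Properties using (sum-↭)
open import Data.Nat.Tactic.RingSolver using (solve-∀)
open import Data.Product using (∃-syntax; _×_; _,_; proj₁; proj₂)
open import Data.Rational using (ℚ; _/_; toℚᵘ; 0ℚ)
import Data.Rational as ℚ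
import Data.Rational.Properties as ℚₚ
open import Data.Rational.Unnormalised using (mkℚᵘ; *≤*; *≡*)
import Data.Rational.Unnormalised as ℚᵘ
import Data.Rational.Unnormalised.Properties as ℚᵘₚ
open import Data.Sum using (inj₁; inj₂)
open import Data.Vec using ([]; _∷_; lookup; tabulate; toList; zip)
open import Data.Vec.Properties using (lookup-replicate; length-toList)
open import Function using (_∘_; id)
open import Relation.Binary.PropositionalEquality
open import Relation.Nullary using (¬_; yes; no; does)
open import Relation.Nullary.Decidable using (decidable-stable; _×-dec_; ¬?)
open import Relation.Nullary.Negation using (contradiction)
open import Defs

-- Polynomially bounded functions

-- Only positive `N` count: enlarging an exponent, as `+-polynomial` does, may shrink a power of 0.
-- Sizes of trees are positive.
Polynomial : (ℕ → ℕ) → Set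
Polynomial f = ∃[ c ] ∃[ d ] ∀ N .{{_ : NonZero N}} → f N ≤ c * N ^ d

const-polynomial : ∀ c → Polynomial λ _ → c
const-polynomial c = c , 0 , λ N → ≤-reflexive (sym (*-identityʳ c))

id-polynomial : Polynomial λ N → N
id-polynomial = 1 , 1 , λ N → ≤-reflexive (sym (trans (*-identityˡ (N ^ 1)) (*-identityʳ N)))

+-polynomial : ∀ {f g} → Polynomial f → Polynomial g → Polynomial λ N → f N + g N
+-polynomial {f} {g} (a , c , f≤) (b , d , g≤) = a + b , c + d , λ N → begin
  f N + g N                              ≤⟨ +-mono-≤ (f≤ N) (g≤ N) ⟩
  a * N ^ c + b * N ^ d                  ≤⟨ +-mono-≤ (*-monoʳ-≤ a (^-monoʳ-≤ N (m≤m+n c d)))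
                                                     (*-monoʳ-≤ b (^-monoʳ-≤ N (m≤n+m d c))) ⟩
  a * N ^ (c + d) + b * N ^ (c + d)      ≡⟨ *-distribʳ-+ (N ^ (c + d)) a b ⟨
  (a + b) * N ^ (c + d)                  ∎
  where open ≤-Reasoning

*-polynomial : ∀ {f g} → Polynomial f → Polynomial g → Polynomial λ N → f N * g N
*-polynomial {f} {g} (a , c , f≤) (b , d , g≤) = a * b , c + d , λ N → begin
  f N * g N                    ≤⟨ *-mono-≤ (f≤ N) (g≤ N) ⟩
  (a * N ^ c) * (b * N ^ d)    ≡⟨ [m*n]*[o*p]≡[m*o]*[n*p] a (N ^ c) b (N ^ d) ⟩
  (a * b) * (N ^ c * N ^ d)    ≡⟨ cong (a * b *_) (^-distribˡ-+-* N c d) ⟨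
  (a * b) * N ^ (c + d)        ∎
  where open ≤-Reasoning

-- A language of bounded loops

data Selector : Set where
  whole : Selector
  hd tl : Selector → Selector

select : Selector → Tree → Tree
select whole  x = x
select (hd p) x = head (select p x)
select (tl p) x = tail (select p x)

-- A term maps an input, which never changes, and a working store to a new
-- store.  `loop p t` runs t once for each element of the list found in the
-- input at p, with that element put in front of the store.  As the store has
-- no influence on the number of iterations, the running time is polynomial in
-- the size of the input, however large the trees in the store are.
data Term : Set where
  store nil : Term
  hd tl     : Term → Term
  _∙_       : Term → Term → Term
  if        : Term → Term → Term → Term
  _▷_       : Term → Term → Term
  loop      : Selector → Term → Term

infixr 4 _▷_

iterateOver : (Tree → Tree → Tree) → Tree → Tree → Tree
iterateOver f nil      s = s
iterateOver f (x ∙ xs) s = iterateOver f xs (f x s)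

if-tree : Tree → Tree → Tree → Tree
if-tree nil     x y = y
if-tree (_ ∙ _) x y = x

⟦_⟧ : Term → Tree → Tree → Tree
⟦ store ⟧    i s = s
⟦ nil ⟧      i s = nil
⟦ hd t ⟧     i s = head (⟦ t ⟧ i s)
⟦ tl t ⟧     i s = tail (⟦ t ⟧ i s)
⟦ t ∙ u ⟧    i s = ⟦ t ⟧ i s ∙ ⟦ u ⟧ i s
⟦ if b t u ⟧ i s = if-tree (⟦ b ⟧ i s) (⟦ t ⟧ i s) (⟦ u ⟧ i s)
⟦ t ▷ u ⟧    i s = ⟦ u ⟧ i (⟦ t ⟧ i s)
⟦ loop p t ⟧ i s = iterateOver (λ x s → ⟦ t ⟧ i (x ∙ s)) (select p i) s

fetch : Selector → Program
fetch whole  = `id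
fetch (hd p) = fetch p ⨾ `head
fetch (tl p) = fetch p ⨾ `tail

-- The state of the `while` is i ∙ (xs ∙ s), where xs are the elements still to
-- be visited.
iteration : Program → Program
iteration p = `pair `head (`pair (`tail ⨾ `head ⨾ `tail)
  (`pair `head (`pair (`tail ⨾ `head ⨾ `head) (`tail ⨾ `tail)) ⨾ p))

compile : Term → Program
compile store      = `tail
compile nil        = `nil
compile (hd t)     = compile t ⨾ `head
compile (tl t)     = compile t ⨾ `tail
compile (t ∙ u)    = `pair (compile t) (compile u)
compile (if b t u) = `if (compile b) (compile t) (compile u)
compile (t ▷ u)    = `pair `head (compile t) ⨾ compile u
compile (loop p t) =
  `pair `head (`pair (`head ⨾ fetch p) `tail) ⨾
  `while (`tail ⨾ `head) (iteration (compile t)) ⨾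
  `tail ⨾ `tail

fetchTime : Selector → ℕ
fetchTime whole  = 1
fetchTime (hd p) = 1 + fetchTime p + 1
fetchTime (tl p) = 1 + fetchTime p + 1

-- An upper bound in the size of the input alone: both branches of a conditional are charged, and a
-- loop is charged `N` passes because its list is a subtree of the input.
time : Term → ℕ → ℕ
time store      N = 1
time nil        N = 1
time (hd t)     N = 2 + time t N
time (tl t)     N = 2 + time t N
time (t ∙ u)    N = 1 + (time t N + time u N)
time (if b t u) N = 1 + (time b N + (time t N + time u N))
time (t ▷ u)    N = 3 + (time t N + time u N)
time (loop p t) N = 15 + (fetchTime p + N * (24 + time t N))

time-polynomial : ∀ t → Polynomial (time t)
time-polynomial store      = const-polynomial 1
time-polynomial nil        = const-polynomial 1
time-polynomial (hd t)     = +-polynomial (const-polynomial 2) (time-polynomial t)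
time-polynomial (tl t)     = +-polynomial (const-polynomial 2) (time-polynomial t)
time-polynomial (t ∙ u)    = +-polynomial (const-polynomial 1)
  (+-polynomial (time-polynomial t) (time-polynomial u))
time-polynomial (if b t u) = +-polynomial (const-polynomial 1)
  (+-polynomial (time-polynomial b) (+-polynomial (time-polynomial t) (time-polynomial u)))
time-polynomial (t ▷ u)    = +-polynomial (const-polynomial 3)
  (+-polynomial (time-polynomial t) (time-polynomial u))
time-polynomial (loop p t) = +-polynomial (const-polynomial 15)
  (+-polynomial (const-polynomial (fetchTime p))
    (*-polynomial id-polynomial (+-polynomial (const-polynomial 24) (time-polynomial t))))

-- Correctness and running time of compiled terms

size-head : ∀ x → size (head x) ≤ size x
size-head nil     = ≤-refl
size-head (x ∙ y) = m≤n⇒m≤1+n (m≤m+n (size x) (size y))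

size-tail : ∀ x → size (tail x) ≤ size x
size-tail nil     = ≤-refl
size-tail (x ∙ y) = m≤n⇒m≤1+n (m≤n+m (size y) (size x))

size-select : ∀ p x → size (select p x) ≤ size x
size-select whole  x = ≤-refl
size-select (hd p) x = ≤-trans (size-head (select p x)) (size-select p x)
size-select (tl p) x = ≤-trans (size-tail (select p x)) (size-select p x)

size-nonZero : ∀ x → NonZero (size x)
size-nonZero nil     = _
size-nonZero (_ ∙ _) = _

spine : Tree → ℕ
spine nil      = 0
spine (_ ∙ xs) = suc (spine xs)

spine≤size : ∀ x → spine x ≤ size x
spine≤size nil      = z≤n
spine≤size (x ∙ xs) = s≤s (≤-trans (spine≤size xs) (m≤n+m (size xs) (size x)))

fetch-run : ∀ p x → fetch p ⊢ x ⇓ select p x [ fetchTime p ]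
fetch-run whole  x = ⇓id
fetch-run (hd p) x = ⇓seq (fetch-run p x) ⇓head
fetch-run (tl p) x = ⇓seq (fetch-run p x) ⇓tail

RunsWithin : Program → Tree → Tree → ℕ → Set
RunsWithin p x y N = ∃[ t ] (p ⊢ x ⇓ y [ t ]) × t ≤ N

-- The last, failing test costs 4. Every pass costs 24 for the test and the rearrangement of the
-- state, besides the body.
while-run : ∀ {p i f N} → (∀ x s → RunsWithin p (i ∙ x ∙ s) (f x s) N) → ∀ xs s →
            RunsWithin (`while (`tail ⨾ `head) (iteration p)) (i ∙ xs ∙ s)
                       (i ∙ nil ∙ iterateOver f xs s) (4 + spine xs * (24 + N))
while-run r nil s = _ , ⇓stop (⇓seq ⇓tail ⇓head) , ≤-refl
while-run {f = f} {N} r (x ∙ xs) s with r x s | while-run r xs (f x s)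
... | t , p⇓ , t≤ | u , w⇓ , u≤ = _
  , ⇓again (⇓seq ⇓tail ⇓head)
      (⇓pair ⇓head (⇓pair (⇓seq ⇓tail (⇓seq ⇓head ⇓tail))
        (⇓seq (⇓pair ⇓head (⇓pair (⇓seq ⇓tail (⇓seq ⇓head ⇓head)) (⇓seq ⇓tail ⇓tail))) p⇓)))
      w⇓
  , (begin
      24 + (t + u)                            ≤⟨ +-monoʳ-≤ 24 (+-mono-≤ t≤ u≤) ⟩
      24 + (N + (4 + spine xs * (24 + N)))    ≡⟨ cong (24 +_) (+-assoc N 4 _) ⟨
      24 + (N + 4 + spine xs * (24 + N))      ≡⟨ cong (λ k → 24 + (k + spine xs * (24 + N))) (+-comm N 4) ⟩
      4 + (24 + N + spine xs * (24 + N))      ∎)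
  where open ≤-Reasoning

compile-run : ∀ t i s → RunsWithin (compile t) (i ∙ s) (⟦ t ⟧ i s) (time t (size i))
compile-run store i s = _ , ⇓tail , ≤-refl
compile-run nil   i s = _ , ⇓nil , ≤-refl
compile-run (hd t) i s with compile-run t i s
... | a , ⇓t , a≤ = _ , ⇓seq ⇓t ⇓head , s≤s (≤-trans (≤-reflexive (+-comm a 1)) (s≤s a≤))
compile-run (tl t) i s with compile-run t i s
... | a , ⇓t , a≤ = _ , ⇓seq ⇓t ⇓tail , s≤s (≤-trans (≤-reflexive (+-comm a 1)) (s≤s a≤))
compile-run (t ∙ u) i s with compile-run t i s | compile-run u i s
... | _ , ⇓t , a≤ | _ , ⇓u , b≤ = _ , ⇓pair ⇓t ⇓u , s≤s (+-mono-≤ a≤ b≤)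
compile-run (if b t u) i s with ⟦ b ⟧ i s | compile-run b i s | compile-run t i s | compile-run u i s
... | nil   | _ , ⇓b , a≤ | _ | _ , ⇓u , c≤ =
  _ , ⇓else ⇓b ⇓u , s≤s (+-mono-≤ a≤ (≤-trans c≤ (m≤n+m _ _)))
... | _ ∙ _ | _ , ⇓b , a≤ | _ , ⇓t , c≤ | _ =
  _ , ⇓then ⇓b ⇓t , s≤s (+-mono-≤ a≤ (≤-trans c≤ (m≤m+n _ _)))
compile-run (t ▷ u) i s with compile-run t i s | compile-run u i (⟦ t ⟧ i s)
... | _ , ⇓t , a≤ | _ , ⇓u , b≤ = _ , ⇓seq (⇓pair ⇓head ⇓t) ⇓u , s≤s (s≤s (s≤s (+-mono-≤ a≤ b≤)))
compile-run (loop p t) i s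
  with while-run {f = λ x s → ⟦ t ⟧ i (x ∙ s)} (λ x s → compile-run t i (x ∙ s)) (select p i) s
... | b , ⇓w , b≤ = _
  , ⇓seq (⇓pair ⇓head (⇓pair (⇓seq ⇓head (fetch-run p i)) ⇓tail)) (⇓seq ⇓w (⇓seq ⇓tail ⇓tail))
  , (begin
      6 + (fetchTime p + 1 + (1 + (b + 3)))       ≡⟨ cong (6 +_) (+-assoc (fetchTime p) 1 _) ⟩
      6 + (fetchTime p + (2 + (b + 3)))
        ≤⟨ +-monoʳ-≤ 6 (+-monoʳ-≤ (fetchTime p) (+-monoʳ-≤ 2 (≤-trans (≤-reflexive (+-comm b 3)) (+-monoʳ-≤ 3 bound)))) ⟩
      6 + (fetchTime p + (9 + size i * k))        ≡⟨ cong (6 +_) (+-assoc (fetchTime p) 9 _) ⟨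
      6 + (fetchTime p + 9 + size i * k)          ≡⟨ cong (λ n → 6 + (n + size i * k)) (+-comm (fetchTime p) 9) ⟩
      15 + (fetchTime p + size i * k)             ∎)
  where
  open ≤-Reasoning
  k = 24 + time t (size i)
  bound : b ≤ 4 + size i * k
  bound = ≤-trans b≤ (+-monoʳ-≤ 4 (*-monoˡ-≤ k (≤-trans (spine≤size (select p i)) (size-select p i))))

-- The program

vertices edges q₁-selector : Selector
vertices    = hd (hd whole)
edges       = tl (hd whole)
q₁-selector = hd (tl (tl whole))

nth : Selector → ℕ → Selector
nth p zero    = hd p
nth p (suc j) = nth (tl p) j

-- Index `k` is the last of `k + 1` tiers, so `main k` serves instances with `suc k` tiers.
qₖ-selector : ℕ → Selector
qₖ-selector k = nth (tl (tl whole)) k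

`true : Term
`true = nil ∙ nil

-- In the body of a loop, the store is the current element followed by the
-- old store.
old : Term
old = tl store

-- One unit is cancelled from both unary numbers per vertex. Names are below n, so at least one
-- number is used up in the end, and they were equal exactly if both are.
equalBody bothNil `equal : Term
equalBody = if (hd old) (if (tl old) (tl (hd old) ∙ tl (tl old)) old) old
bothNil   = if (hd store) nil (if (tl store) nil `true)
`equal    = loop vertices equalBody ▷ bothNil

-- A list in the store cannot drive a `loop`; the edge list of the input serves as a clock instead,
-- moving one element per tick. This suffices for lists of at most m elements.
reverseBody `reverse : Term
reverseBody = if (hd old) (tl (hd old) ∙ hd (hd old) ∙ tl old) old
`reverse    = (store ∙ nil) ▷ loop edges reverseBody ▷ tl store

-- `map t` expects a store c ∙ ts and applies t to c ∙ x for every x in ts.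
mapBody `map : Term → Term
mapBody t = if (hd (tl old))
  (hd old ∙ tl (hd (tl old)) ∙ ((hd old ∙ hd (hd (tl old))) ▷ t) ∙ tl (tl old))
  old
`map t    = (hd store ∙ tl store ∙ nil) ▷ loop edges (mapBody t) ▷ tl (tl store) ▷ `reverse

`merge : Term
`merge = if ((tl store ∙ tl (hd store)) ▷ `equal) (hd (hd store)) (tl store)

`relabel : Term
`relabel = (((hd store ∙ hd (hd (tl store))) ▷ `merge) ∙ ((hd store ∙ tl (hd (tl store))) ▷ `merge))
         ∙ tl (tl store)

-- After the current element, the store is W ∙ marks: the edges still to be
-- processed, with their current names, and the marks of the processed ones.
contractBody `contract : Term
contractBody = if (tl (hd (hd old)))
  (tl (hd old) ∙ `true ∙ tl old)
  (if (hd (hd (hd old)) ▷ `equal)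
    (tl (hd old) ∙ nil ∙ tl old)
    (((hd (hd (hd old)) ∙ tl (hd old)) ▷ `map `relabel) ∙ `true ∙ tl old))
`contract    = (store ∙ nil) ▷ loop edges contractBody ▷ tl store

-- The accumulator reverses the list. This is left as it is, since the accumulator of `contract`
-- restores the original order of the marks.
zipBody `zip : Term
zipBody = tl (hd old) ∙ (hd store ∙ hd (hd old)) ∙ tl old
`zip    = (store ∙ nil) ▷ loop edges zipBody ▷ tl store

`augment : Term
`augment = `zip ▷ `contract

-- After the current element, the store is (b ∙ w) ∙ (w′ ∙ s); for each edge one
-- unit is moved from w, adding two units to w′ and the digit b to s.
digitBody `addDigit : Term
digitBody = if (tl (hd old))
  ((hd (hd old) ∙ tl (tl (hd old))) ∙ (nil ∙ nil ∙ hd (tl old)) ∙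
    if (hd (hd old)) (nil ∙ tl (tl old)) (nil ∙ nil ∙ tl (tl old)))
  old
`addDigit = ((hd store ∙ hd old) ∙ nil ∙ tl old) ▷ loop edges digitBody ▷ tl store

`unary : Selector → Term
-- `true` doubles as the unary numeral 1, the place value of the first digit.
`unary p = (`true ∙ nil) ▷ loop p `addDigit ▷ tl store

-- After the current element, the store is (p ∙ q) ∙ F with unary p and q.
scheduleBody : Term
scheduleBody = if (tl (hd old))
  (if (hd (hd old))
    ((tl (hd (hd old)) ∙ tl (tl (hd old))) ∙ tl old)
    ((nil ∙ tl (tl (hd old))) ∙ (tl old ▷ `augment)))
  old

`main : ℕ → Term
`main k = ((`unary q₁-selector ∙ `unary (qₖ-selector k)) ∙ store)
        ▷ loop edges scheduleBody ▷ tl store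

-- Contraction and scheduling on marked lists

Edge : ℕ → Set
Edge n = Fin n × Fin n

module _ {n : ℕ} where

  merge : Fin n → Fin n → Fin n → Fin n
  merge u v x = if does (x Fin.≟ v) then u else x

  -- ρ sends a vertex to the name of the component that contains it.
  contract : (Fin n → Fin n) → List (Edge n × Bool) → List (Edge n × Bool)
  contract ρ []                        = []
  contract ρ ((e , true) ∷ W)          = (e , true) ∷ contract ρ W
  contract ρ ((e@(u , v) , false) ∷ W) with ρ u Fin.≟ ρ v
  ... | yes _ = (e , false) ∷ contract ρ W
  ... | no  _ = (e , true) ∷ contract (merge (ρ u) (ρ v) ∘ ρ) W

  -- The reversals mirror the accumulators of the program; a maximal forest results from any order
  -- of the edges.
  augment : List (Edge n × Bool) → List (Edge n × Bool)
  augment W = reverse (contract id (reverse W))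

  -- Every tick takes a unit of `q`, and an augmentation happens only once `p` is used up. One loop
  -- thus performs both the subtraction and the truncation of the number of rounds.
  schedule : ℕ → ℕ → ℕ → List (Edge n × Bool) → List (Edge n × Bool)
  schedule zero    p       q       W = W
  schedule (suc m) p       zero    W = schedule m p zero W
  schedule (suc m) (suc p) (suc q) W = schedule m p q W
  schedule (suc m) zero    (suc q) W = schedule m zero q (augment W)

  contract-edges : ∀ ρ W → map proj₁ (contract ρ W) ≡ map proj₁ W
  contract-edges ρ []                        = refl
  contract-edges ρ ((e , true) ∷ W)          = cong (e ∷_) (contract-edges ρ W)
  contract-edges ρ ((e@(u , v) , false) ∷ W) with ρ u Fin.≟ ρ v
  ... | yes _ = cong (e ∷_) (contract-edges ρ W)
  ... | no  _ = cong (e ∷_) (contract-edges (merge (ρ u) (ρ v) ∘ ρ) W)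

  augment-edges : ∀ W → map proj₁ (augment W) ≡ map proj₁ W
  augment-edges W = begin
    map proj₁ (reverse (contract id (reverse W)))  ≡⟨ map-ʳ++ proj₁ (contract id (reverse W)) ⟩
    reverse (map proj₁ (contract id (reverse W)))  ≡⟨ cong reverse (contract-edges id (reverse W)) ⟩
    reverse (map proj₁ (reverse W))                ≡⟨ cong reverse (map-ʳ++ proj₁ W) ⟩
    reverse (reverse (map proj₁ W))                ≡⟨ ʳ++-ʳ++ (map proj₁ W) ⟩
    map proj₁ W ++ᴸ []                             ≡⟨ ++-identityʳ _ ⟩
    map proj₁ W                                    ∎
    where open ≡-Reasoning

  encodeEdge : Edge n → Tree
  encodeEdge (u , v) = encodeUnary (Fin.toℕ u) ∙ encodeUnary (Fin.toℕ v)

  -- The program keeps no table of `ρ`: pending edges carry the current component names of their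
  -- ends, whereas the list function keeps the original ends next to `ρ`.
  encodeMarked : (Fin n → Fin n) → Edge n × Bool → Tree
  encodeMarked ρ ((u , v) , b) = encodeEdge (ρ u , ρ v) ∙ encodeBool b

  encodeMarks : List (Edge n × Bool) → Tree
  encodeMarks W = encodeList (map (encodeBool ∘ proj₂) W)

≡ᵇ-toℕ : ∀ {n} (u v : Fin n) → (Fin.toℕ u ≡ᵇ Fin.toℕ v) ≡ does (u Fin.≟ v)
≡ᵇ-toℕ zero    zero    = refl
≡ᵇ-toℕ zero    (suc v) = refl
≡ᵇ-toℕ (suc u) zero    = refl
≡ᵇ-toℕ (suc u) (suc v) = ≡ᵇ-toℕ u v

-- w is the place value of the next digit and s the value of the digits read so
-- far, both correct only up to truncation at m: as unary numbers they would
-- otherwise be exponentially long.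
digits : ℕᵇ → ℕ → ℕ → ℕ → ℕ
digits ℕᵇ.zero  m w s = s
digits 2[1+ x ] m w s = digits x m (2 * (w ⊓ m)) (s + 2 * (w ⊓ m))
digits 1+[2 x ] m w s = digits x m (2 * (w ⊓ m)) (s + (w ⊓ m))

-- What the terms compute

module Semantics {n : ℕ} (L : List (Edge n)) (r : Tree) where

  input : Tree
  input = (encodeUnary n ∙ encodeList (map encodeEdge L)) ∙ r

  private
    step : Term → Tree → Tree → Tree
    step t x s = ⟦ t ⟧ input (x ∙ s)

  ⟦equal⟧ : ∀ u v → ⟦ `equal ⟧ input (encodeEdge (u , v)) ≡ encodeBool (does (u Fin.≟ v))
  ⟦equal⟧ u v = trans
    (go n (Fin.toℕ u) (Fin.toℕ v) (≤-trans (m⊓n≤m _ _) (<⇒≤ (Finₚ.toℕ<n u))))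
    (cong encodeBool (≡ᵇ-toℕ u v))
    where
    go : ∀ n a b → a ⊓ b ≤ n →
         ⟦ bothNil ⟧ input (iterateOver (step equalBody) (encodeUnary n) (encodeUnary a ∙ encodeUnary b))
         ≡ encodeBool (a ≡ᵇ b)
    go zero    zero    zero    _       = refl
    go zero    zero    (suc b) _       = refl
    go zero    (suc a) zero    _       = refl
    go (suc n) zero    b       _       = go n zero b z≤n
    go (suc n) (suc a) zero    _       = go n (suc a) zero z≤n
    go (suc n) (suc a) (suc b) (s≤s h) = go n a b h

  ⟦reverse⟧ : ∀ ts → length ts ≤ length L →
              ⟦ `reverse ⟧ input (encodeList ts) ≡ encodeList (reverse ts)
  ⟦reverse⟧ ts h = cong tail (go L ts [] h)
    where
    go : ∀ (L : List (Edge n)) ts us → length ts ≤ length L →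
         iterateOver (step reverseBody) (encodeList (map encodeEdge L)) (encodeList ts ∙ encodeList us)
         ≡ nil ∙ encodeList (ts ʳ++ us)
    go []      []       us _       = refl
    go (_ ∷ L) []       us _       = go L [] us z≤n
    go (_ ∷ L) (t ∷ ts) us (s≤s h) = go L ts (t ∷ us) h

  ⟦map⟧ : ∀ t c ts → length ts ≤ length L →
          ⟦ `map t ⟧ input (c ∙ encodeList ts) ≡ encodeList (map (step t c) ts)
  ⟦map⟧ t c ts h = begin
    ⟦ `map t ⟧ input (c ∙ encodeList ts)
      ≡⟨ cong (⟦ `reverse ⟧ input ∘ tail ∘ tail) (go L ts [] h) ⟩
    ⟦ `reverse ⟧ input (encodeList (map (step t c) ts ʳ++ []))
      ≡⟨ ⟦reverse⟧ (map (step t c) ts ʳ++ []) (≤-trans (≤-reflexive len) h) ⟩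
    encodeList ((map (step t c) ts ʳ++ []) ʳ++ [])
      ≡⟨ cong encodeList (ʳ++-ʳ++ (map (step t c) ts)) ⟩
    encodeList (map (step t c) ts ++ᴸ [])
      ≡⟨ cong encodeList (++-identityʳ _) ⟩
    encodeList (map (step t c) ts) ∎
    where
    open ≡-Reasoning
    go : ∀ (L : List (Edge n)) ts us → length ts ≤ length L →
         iterateOver (step (mapBody t)) (encodeList (map encodeEdge L)) (c ∙ encodeList ts ∙ encodeList us)
         ≡ c ∙ nil ∙ encodeList (map (step t c) ts ʳ++ us)
    go []      []       us _       = refl
    go (_ ∷ L) []       us _       = go L [] us z≤n
    go (_ ∷ L) (x ∷ ts) us (s≤s h) = go L ts (step t c x ∷ us) h
    len : length (map (step t c) ts ʳ++ []) ≡ length ts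
    len = trans (length-ʳ++ (map (step t c) ts))
      (trans (+-identityʳ _) (length-map (step t c) ts))

  ⟦merge⟧ : ∀ u v x → step `merge (encodeEdge (u , v)) (encodeUnary (Fin.toℕ x))
                      ≡ encodeUnary (Fin.toℕ (merge u v x))
  ⟦merge⟧ u v x rewrite ⟦equal⟧ x v with does (x Fin.≟ v)
  ... | true  = refl
  ... | false = refl

  ⟦relabel⟧ : ∀ ρ u v e → step `relabel (encodeEdge (u , v)) (encodeMarked ρ e)
                          ≡ encodeMarked (merge u v ∘ ρ) e
  ⟦relabel⟧ ρ u v ((x , y) , b) =
    cong₂ (λ x y → (x ∙ y) ∙ encodeBool b) (⟦merge⟧ u v (ρ x)) (⟦merge⟧ u v (ρ y))

  ⟦contract⟧ : ∀ W → length W ≡ length L →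
               ⟦ `contract ⟧ input (encodeList (map (encodeMarked id) W))
               ≡ encodeMarks (reverse (contract id W))
  ⟦contract⟧ W h = trans (cong tail (go L id W [] ≤-refl (sym h)))
    (cong encodeList (sym (map-ʳ++ (encodeBool ∘ proj₂) (contract id W))))
    where
    marks = map (λ (w : Edge n × Bool) → encodeBool (proj₂ w))
    -- `M` is the rest of the clock. That it is no longer than `L` lets the inner `map`, whose clock
    -- is all of `L`, reach every pending edge.
    go : ∀ (M : List (Edge n)) ρ W ts → length M ≤ length L → length M ≡ length W →
         iterateOver (step contractBody) (encodeList (map encodeEdge M))
           (encodeList (map (encodeMarked ρ) W) ∙ encodeList ts)
         ≡ nil ∙ encodeList (marks (contract ρ W) ʳ++ ts)
    go []      ρ []                        ts _ _  = refl
    go (_ ∷ M) ρ ((e , true) ∷ W)          ts l eq = go M ρ W _ (<⇒≤ l) (suc-injective eq)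
    go (x ∷ M) ρ ((e@(u , v) , false) ∷ W) ts l eq
      rewrite ⟦equal⟧ (ρ u) (ρ v) with ρ u Fin.≟ ρ v
    ... | yes _ = go M ρ W _ (<⇒≤ l) (suc-injective eq)
    ... | no  _ = trans
      (cong (λ z → iterateOver (step contractBody) (encodeList (map encodeEdge M)) (z ∙ encodeList (encodeBool true ∷ ts)))
        relabelled)
      (go M (merge (ρ u) (ρ v) ∘ ρ) W _ (<⇒≤ l) (suc-injective eq))
      where
      relabelled : step (`map `relabel) (encodeEdge (ρ u , ρ v)) (encodeList (map (encodeMarked ρ) W))
                   ≡ encodeList (map (encodeMarked (merge (ρ u) (ρ v) ∘ ρ)) W)
      relabelled = trans
        (⟦map⟧ `relabel _ (map (encodeMarked ρ) W)
          (≤-trans (≤-reflexive (trans (length-map (encodeMarked ρ) W) (sym (suc-injective eq)))) (<⇒≤ l)))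
        (cong encodeList (trans (sym (map-∘ W)) (map-cong (⟦relabel⟧ ρ (ρ u) (ρ v)) W)))

  ⟦zip⟧ : ∀ W → map proj₁ W ≡ L →
          ⟦ `zip ⟧ input (encodeMarks W) ≡ encodeList (map (encodeMarked id) (reverse W))
  ⟦zip⟧ W refl = trans (cong tail (go W []))
    (cong encodeList (sym (map-ʳ++ (encodeMarked id) W)))
    where
    go : ∀ W ts → iterateOver (step zipBody) (encodeList (map encodeEdge (map proj₁ W)))
                    (encodeMarks W ∙ encodeList ts)
                  ≡ nil ∙ encodeList (map (encodeMarked id) W ʳ++ ts)
    go []      ts = refl
    go (_ ∷ W) ts = go W _

  ⟦augment⟧ : ∀ W → map proj₁ W ≡ L →
              ⟦ `augment ⟧ input (encodeMarks W) ≡ encodeMarks (augment W)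
  ⟦augment⟧ W h = trans (cong (⟦ `contract ⟧ input) (⟦zip⟧ W h)) (⟦contract⟧ (reverse W) (begin
    length (W ʳ++ [])     ≡⟨ length-ʳ++ W ⟩
    length W + 0          ≡⟨ +-identityʳ _ ⟩
    length W              ≡⟨ length-map proj₁ W ⟨
    length (map proj₁ W)  ≡⟨ cong length h ⟩
    length L              ∎))
    where open ≡-Reasoning

  -- The digits of `ℕᵇ` are 1 and 2, encoded as `true` and `false`. Each tick moves at most one unit
  -- of `w`, whence the truncation at the number of edges.
  ⟦addDigit⟧ : ∀ b w s →
    step `addDigit (encodeBool b) (encodeUnary w ∙ encodeUnary s)
    ≡ encodeUnary (2 * (w ⊓ length L)) ∙ encodeUnary (s + (if b then 1 else 2) * (w ⊓ length L))
  ⟦addDigit⟧ b w s = cong tail (go L w 0 s)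
    where
    c = if b then 1 else 2
    state : ℕ → ℕ → ℕ → Tree
    state w w′ s = (encodeBool b ∙ encodeUnary w) ∙ encodeUnary w′ ∙ encodeUnary s
    unchanged : ∀ c w w′ s → state w w′ s ≡ state w (w′ + 0) (s + c * 0)
    unchanged c w w′ s = cong₂ (state w) (sym (+-identityʳ w′))
      (sym (trans (cong (s +_) (*-zeroʳ c)) (+-identityʳ s)))
    double-suc : ∀ x y → suc (suc (x + 2 * y)) ≡ x + 2 * suc y
    double-suc = solve-∀
    go : ∀ (M : List (Edge n)) w w′ s →
         iterateOver (step digitBody) (encodeList (map encodeEdge M)) (state w w′ s)
         ≡ state (w ∸ length M) (w′ + 2 * (w ⊓ length M)) (s + c * (w ⊓ length M))
    go []      zero    w′ s = unchanged c 0 w′ s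
    go []      (suc w) w′ s = unchanged c (suc w) w′ s
    go (_ ∷ M) zero    w′ s = trans (go M zero w′ s)
      (cong (λ w → state w (w′ + 0) (s + c * 0)) (0∸n≡0 (length M)))
    go (_ ∷ M) (suc w) w′ s = trans (cong (iterateOver (step digitBody) (encodeList (map encodeEdge M))) (digit b))
      (trans (go M w (2 + w′) (c + s)) (cong₂ (state (w ∸ length M))
        (double-suc w′ (w ⊓ length M))
        (trans (cong (_+ c * k) (+-comm c s)) (trans (+-assoc s c (c * k)) (cong (s +_) (sym (*-suc c k)))))))
      where
      k = w ⊓ length M
      digit : ∀ b → step digitBody nil ((encodeBool b ∙ encodeUnary (suc w)) ∙ encodeUnary w′ ∙ encodeUnary s)
              ≡ (encodeBool b ∙ encodeUnary w) ∙ encodeUnary (2 + w′) ∙ encodeUnary ((if b then 1 else 2) + s)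
      digit true  = refl
      digit false = refl

  ⟦unary⟧ : ∀ p x → select p input ≡ encodeBinary x → ∀ s₀ →
            ⟦ `unary p ⟧ input s₀ ≡ encodeUnary (digits x (length L) 1 0)
  ⟦unary⟧ p x eq s₀ rewrite eq = go x 1 0
    where
    go : ∀ x w s → tail (iterateOver (step `addDigit) (encodeBinary x) (encodeUnary w ∙ encodeUnary s))
                   ≡ encodeUnary (digits x (length L) w s)
    go ℕᵇ.zero  w s = refl
    go 2[1+ x ] w s = trans
      (cong (tail ∘ iterateOver (step `addDigit) (encodeBinary x)) (⟦addDigit⟧ false w s))
      (go x _ _)
    go 1+[2 x ] w s = trans
      (cong (tail ∘ iterateOver (step `addDigit) (encodeBinary x))
        (trans (⟦addDigit⟧ true w s)
          (cong (λ k → encodeUnary (2 * (w ⊓ length L)) ∙ encodeUnary (s + k)) (*-identityˡ (w ⊓ length L)))))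
      (go x _ _)

  ⟦main⟧ : ∀ k x y → select q₁-selector input ≡ encodeBinary x →
           select (qₖ-selector k) input ≡ encodeBinary y →
           ∀ W → map proj₁ W ≡ L →
           ⟦ `main k ⟧ input (encodeMarks W) ≡
           encodeMarks (schedule (length L) (digits x (length L) 1 0) (digits y (length L) 1 0) W)
  ⟦main⟧ k x y x-eq y-eq W W-edges = begin
    ⟦ `main k ⟧ input (encodeMarks W)
      ≡⟨ cong₂ (λ p q → tail (iterateOver (step scheduleBody) (encodeList (map encodeEdge L)) ((p ∙ q) ∙ encodeMarks W)))
           (⟦unary⟧ q₁-selector x x-eq (encodeMarks W)) (⟦unary⟧ (qₖ-selector k) y y-eq (encodeMarks W)) ⟩
    tail (iterateOver (step scheduleBody) (encodeList (map encodeEdge L)) (state p₀ q₀ W))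
      ≡⟨ go L p₀ q₀ W W-edges ⟩
    encodeMarks (schedule (length L) p₀ q₀ W) ∎
    where
    open ≡-Reasoning
    p₀ = digits x (length L) 1 0
    q₀ = digits y (length L) 1 0
    state : ℕ → ℕ → List (Edge n × Bool) → Tree
    state p q W = (encodeUnary p ∙ encodeUnary q) ∙ encodeMarks W
    go : ∀ (M : List (Edge n)) p q W → map proj₁ W ≡ L →
         tail (iterateOver (step scheduleBody) (encodeList (map encodeEdge M)) (state p q W))
         ≡ encodeMarks (schedule (length M) p q W)
    go []      p       q       W h = refl
    go (_ ∷ M) p       zero    W h = go M p zero W h
    go (_ ∷ M) (suc p) (suc q) W h = go M p q W h
    go (_ ∷ M) zero    (suc q) W h = trans
      (cong (λ t → tail (iterateOver (step scheduleBody) (encodeList (map encodeEdge M)) ((nil ∙ encodeUnary q) ∙ t)))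
        (⟦augment⟧ W h))
      (go M zero q (augment W) (trans (augment-edges W) h))

-- Capped binary conversion

-- The coefficient is positive, so a `w` beyond `m` lifts both sides to the cap.
⊓-absorb : ∀ m s c w → (s + suc c * (w ⊓ m)) ⊓ m ≡ (s + suc c * w) ⊓ m
⊓-absorb m s c w with ≤-total w m
... | inj₁ w≤m = cong (λ k → (s + suc c * k) ⊓ m) (m≤n⇒m⊓n≡m w≤m)
... | inj₂ m≤w = begin
  (s + suc c * (w ⊓ m)) ⊓ m ≡⟨ cong (λ k → (s + suc c * k) ⊓ m) (m≥n⇒m⊓n≡n m≤w) ⟩
  (s + suc c * m) ⊓ m       ≡⟨ m≥n⇒m⊓n≡n (reaches ≤-refl) ⟩
  m                         ≡⟨ m≥n⇒m⊓n≡n (reaches m≤w) ⟨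
  (s + suc c * w) ⊓ m       ∎
  where
  open ≡-Reasoning
  reaches : ∀ {k} → m ≤ k → m ≤ s + suc c * k
  reaches {k} m≤k = ≤-trans m≤k (≤-trans (m≤m+n k (c * k)) (m≤n+m _ s))

-- The value of `digits` can itself exceed `m` and be wrong there, so only capped values are
-- compared. The place value always has a positive coefficient, as `⊓-absorb` requires.
digits-⊓ : ∀ x m w s → digits x m w s ⊓ m ≡ (s + toℕ x * w) ⊓ m
digits-⊓ ℕᵇ.zero  m w s = cong (_⊓ m) (sym (+-identityʳ s))
digits-⊓ 2[1+ x ] m w s = trans (digits-⊓ x m _ _)
  (trans (cong (_⊓ m) (even s (w ⊓ m) (toℕ x))) (⊓-absorb m s (toℕ x + suc (toℕ x + 0)) w))
  where
  even : ∀ s k x → s + 2 * k + x * (2 * k) ≡ s + (2 * suc x) * k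
  even = solve-∀
digits-⊓ 1+[2 x ] m w s = trans (digits-⊓ x m _ _)
  (trans (cong (_⊓ m) (odd s (w ⊓ m) (toℕ x))) (⊓-absorb m s (2 * toℕ x) w))
  where
  odd : ∀ s k x → s + k + x * (2 * k) ≡ s + suc (2 * x) * k
  odd = solve-∀

-- Counting marked edges

bit : Bool → ℕ
bit b = if b then 1 else 0

module _ {n : ℕ} where

  crosses : Subset n → Edge n → Bool
  crosses R (u , v) = lookup R u xor lookup R v

  crossingMark : Subset n → Edge n × Bool → ℕ
  crossingMark R (e , b) = bit (crosses R e ∧ b)

  marked : List (Edge n × Bool) → ℕ
  marked W = sum (map (bit ∘ proj₂) W)

  -- When `W` marks the edge set F, these are |δ(R) ∩ F| and |δ(R)|.
  cut boundary : Subset n → List (Edge n × Bool) → ℕ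
  cut      R W = sum (map (crossingMark R) W)
  boundary R W = sum (map (bit ∘ crosses R ∘ proj₁) W)

  contract-cut-≤ : ∀ R ρ W → cut R W ≤ cut R (contract ρ W)
  contract-cut-≤ R ρ []                        = ≤-refl
  contract-cut-≤ R ρ ((e , true) ∷ W)          = +-monoʳ-≤ (bit _) (contract-cut-≤ R ρ W)
  contract-cut-≤ R ρ ((e@(u , v) , false) ∷ W) with ρ u Fin.≟ ρ v
  ... | yes _ = +-monoʳ-≤ (bit _) (contract-cut-≤ R ρ W)
  ... | no  _ = +-mono-≤ (≤-trans (≤-reflexive (cong bit (∧-zeroʳ _))) z≤n)
                         (contract-cut-≤ R _ W)

  -- Preserves the invariant of `contract-cut`: the name of a component lies on the same side of `R`
  -- as its vertices.
  merge-side : ∀ (R : Subset n) (ρ : Fin n → Fin n) → (∀ x → lookup R (ρ x) ≡ lookup R x) →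
               ∀ {u v} → lookup R u ≡ lookup R v →
               ∀ x → lookup R (merge (ρ u) (ρ v) (ρ x)) ≡ lookup R x
  merge-side R ρ inv {u} {v} u~v x with ρ x Fin.≟ ρ v
  ... | yes eq = trans (inv u) (trans u~v (trans (sym (inv v)) (trans (cong (lookup R) (sym eq)) (inv x))))
  ... | no  _  = inv x

  -- As long as no edge of the cut R is newly marked, every component lies on one
  -- side of R, so the first unmarked edge of the cut joins two components.
  contract-cut : ∀ R ρ → (∀ x → lookup R (ρ x) ≡ lookup R x) → ∀ W →
                 boundary R W ⊓ suc (cut R W) ≤ cut R (contract ρ W)
  contract-cut R ρ inv []               = z≤n
  contract-cut R ρ inv ((e , true) ∷ W) = begin
    (c + boundary R W) ⊓ suc (bit (crosses R e ∧ true) + cut R W)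
      ≡⟨ cong (λ b → (c + boundary R W) ⊓ suc (bit b + cut R W)) (∧-identityʳ _) ⟩
    (c + boundary R W) ⊓ suc (c + cut R W)
      ≡⟨ cong ((c + boundary R W) ⊓_) (+-suc c _) ⟨
    (c + boundary R W) ⊓ (c + suc (cut R W))
      ≡⟨ +-distribˡ-⊓ c _ _ ⟨
    c + boundary R W ⊓ suc (cut R W)
      ≤⟨ +-monoʳ-≤ c (contract-cut R ρ inv W) ⟩
    c + cut R (contract ρ W)
      ≡⟨ cong (λ b → bit b + cut R (contract ρ W)) (∧-identityʳ _) ⟨
    bit (crosses R e ∧ true) + cut R (contract ρ W) ∎
    where
    open ≤-Reasoning
    c = bit (crosses R e)
  contract-cut R ρ inv ((e@(u , v) , false) ∷ W) with ρ u Fin.≟ ρ v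
  ... | yes eq
    rewrite trans (sym (inv u)) (trans (cong (lookup R) eq) (inv v)) | xor-same (lookup R v)
    = contract-cut R ρ inv W
  ... | no _ with lookup R u in u-side | lookup R v in v-side
  -- The new mark supplies the additional unit, so the invariant on `ρ` can be given up from here
  -- on.
  ...   | true  | false = ≤-trans (m⊓n≤n (suc (boundary R W)) _) (s≤s (contract-cut-≤ R _ W))
  ...   | false | true  = ≤-trans (m⊓n≤n (suc (boundary R W)) _) (s≤s (contract-cut-≤ R _ W))
  ...   | true  | true  = contract-cut R _ (merge-side R ρ inv {u} {v} (trans u-side (sym v-side))) W
  ...   | false | false = contract-cut R _ (merge-side R ρ inv {u} {v} (trans u-side (sym v-side))) W

  -- Each newly marked edge removes one name from S, and S never becomes empty.
  contract-marked : ∀ ρ S → (∀ x → ρ x ∈ S) → ∀ W →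
                    marked (contract ρ W) ≤ marked W + (∣ S ∣ ∸ 1)
  contract-marked ρ S in-S []                        = z≤n
  contract-marked ρ S in-S ((e , true) ∷ W)          = s≤s (contract-marked ρ S in-S W)
  contract-marked ρ S in-S ((e@(u , v) , false) ∷ W) with ρ u Fin.≟ ρ v
  ... | yes _  = contract-marked ρ S in-S W
  ... | no  u≢v = begin
    suc (marked (contract (merge (ρ u) (ρ v) ∘ ρ) W))  ≤⟨ s≤s (contract-marked _ S′ in-S′ W) ⟩
    suc (marked W + (∣ S′ ∣ ∸ 1))                      ≡⟨ +-suc (marked W) _ ⟨
    marked W + suc (∣ S′ ∣ ∸ 1)                        ≡⟨ cong (marked W +_) (m+[n∸m]≡n S′-nonempty) ⟩
    marked W + ∣ S′ ∣
      ≤⟨ +-monoʳ-≤ (marked W) (∸-monoˡ-≤ 1 (x∈p⇒∣p-x∣<∣p∣ (in-S v))) ⟩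
    marked W + (∣ S ∣ ∸ 1)                             ∎
    where
    open ≤-Reasoning
    S′ = S - ρ v
    u∈S′ : ρ u ∈ S′
    u∈S′ = x∈p∧x≢y⇒x∈p-y (in-S u) u≢v
    S′-nonempty : 1 ≤ ∣ S′ ∣
    S′-nonempty = ≤-trans (s≤s z≤n) (x∈p⇒∣p-x∣<∣p∣ u∈S′)
    in-S′ : ∀ x → merge (ρ u) (ρ v) (ρ x) ∈ S′
    in-S′ x with ρ x Fin.≟ ρ v
    ... | yes _   = u∈S′
    ... | no  x≢v = x∈p∧x≢y⇒x∈p-y (in-S x) x≢v

  sum-reverse : ∀ (f : Edge n × Bool → ℕ) W → sum (map f (reverse W)) ≡ sum (map f W)
  sum-reverse f W = sum-↭ (map⁺ f (↭-reverse W))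

  augment-cut : ∀ R W → boundary R W ⊓ suc (cut R W) ≤ cut R (augment W)
  augment-cut R W = begin
    boundary R W ⊓ suc (cut R W)                      ≡⟨ cong₂ (λ a b → a ⊓ suc b)
                                                            (sum-reverse (bit ∘ crosses R ∘ proj₁) W)
                                                            (sum-reverse (crossingMark R) W) ⟨
    boundary R (reverse W) ⊓ suc (cut R (reverse W))  ≤⟨ contract-cut R id (λ _ → refl) (reverse W) ⟩
    cut R (contract id (reverse W))                   ≡⟨ sum-reverse (crossingMark R) (contract id (reverse W)) ⟨
    cut R (augment W)                                 ∎
    where open ≤-Reasoning

  augment-marked : ∀ W → marked (augment W) ≤ marked W + (n ∸ 1)
  augment-marked W = begin
    marked (augment W)                    ≡⟨ sum-reverse (bit ∘ proj₂) (contract id (reverse W)) ⟩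
    marked (contract id (reverse W))      ≤⟨ contract-marked id ⊤ (λ _ → ∈⊤) (reverse W) ⟩
    marked (reverse W) + (∣ ⊤ {n} ∣ ∸ 1)  ≡⟨ cong₂ (λ a b → a + (b ∸ 1)) (sum-reverse (bit ∘ proj₂) W) (∣⊤∣≡n n) ⟩
    marked W + (n ∸ 1)                    ∎
    where open ≤-Reasoning

  boundary-edges : ∀ R V W → map proj₁ V ≡ map proj₁ W → boundary R V ≡ boundary R W
  boundary-edges R []      []      eq = refl
  boundary-edges R (_ ∷ V) (_ ∷ W) eq = cong₂ (λ e → bit (crosses R e) +_)
    (∷-injectiveˡ eq) (boundary-edges R V W (∷-injectiveʳ eq))

  augments : ℕ → List (Edge n × Bool) → List (Edge n × Bool)
  augments zero    W = W
  augments (suc j) W = augments j (augment W)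

  schedule-augments : ∀ m p q W → schedule m p q W ≡ augments ((q ⊓ m) ∸ p) W
  schedule-augments zero    p       q       W = cong (λ j → augments j W)
    (sym (trans (cong (_∸ p) (⊓-zeroʳ q)) (0∸n≡0 p)))
  schedule-augments (suc m) p       zero    W = schedule-augments m p zero W
  schedule-augments (suc m) (suc p) (suc q) W = schedule-augments m p q W
  schedule-augments (suc m) zero    (suc q) W = schedule-augments m zero q (augment W)

  augments-edges : ∀ j W → map proj₁ (augments j W) ≡ map proj₁ W
  augments-edges zero    W = refl
  augments-edges (suc j) W = trans (augments-edges j (augment W)) (augment-edges W)

  augments-marked : ∀ j W → marked (augments j W) ≤ marked W + j * (n ∸ 1)
  augments-marked zero    W = m≤m+n _ 0
  augments-marked (suc j) W = begin
    marked (augments j (augment W))         ≤⟨ augments-marked j (augment W) ⟩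
    marked (augment W) + j * (n ∸ 1)        ≤⟨ +-monoˡ-≤ _ (augment-marked W) ⟩
    marked W + (n ∸ 1) + j * (n ∸ 1)        ≡⟨ +-assoc (marked W) _ _ ⟩
    marked W + suc j * (n ∸ 1)              ∎
    where open ≤-Reasoning

  -- Each round gains an edge of the cut until the boundary is exhausted; the boundary stays fixed
  -- because only marks change.
  augments-cut : ∀ R j W → boundary R W ⊓ (j + cut R W) ≤ cut R (augments j W)
  augments-cut R zero    W = m⊓n≤n (boundary R W) _
  augments-cut R (suc j) W = begin
    B ⊓ (suc j + cut R W)                  ≤⟨ ⊓-glb (m⊓n≤m B _) step ⟩
    B ⊓ (j + cut R (augment W))            ≡⟨ cong (_⊓ (j + cut R (augment W)))
                                              (boundary-edges R (augment W) W (augment-edges W)) ⟨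
    boundary R (augment W) ⊓ (j + cut R (augment W))
                                           ≤⟨ augments-cut R j (augment W) ⟩
    cut R (augments j (augment W))         ∎
    where
    open ≤-Reasoning
    B = boundary R W
    step : B ⊓ (suc j + cut R W) ≤ j + cut R (augment W)
    step = begin
      -- Weakening `B` to `j + B` allows `j` to be taken out of the minimum.
      B ⊓ (suc j + cut R W)           ≤⟨ ⊓-monoˡ-≤ _ (m≤n+m B j) ⟩
      (j + B) ⊓ (suc j + cut R W)     ≡⟨ cong ((j + B) ⊓_) (+-suc j _) ⟨
      (j + B) ⊓ (j + suc (cut R W))   ≡⟨ +-distribˡ-⊓ j _ _ ⟨
      j + B ⊓ suc (cut R W)           ≤⟨ +-monoʳ-≤ j (augment-cut R W) ⟩
      j + cut R (augment W)           ∎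

-- Degree sums

  ∑-mono : ∀ {k} {f g : Fin k → ℕ} → (∀ i → f i ≤ g i) → ∑ f ≤ ∑ g
  ∑-mono {zero}  h = z≤n
  ∑-mono {suc k} h = +-mono-≤ (h zero) (∑-mono (h ∘ suc))

  ∑-lower : ∀ {k} c {f : Fin k → ℕ} → (∀ i → c ≤ f i) → k * c ≤ ∑ f
  ∑-lower {zero}  c h = z≤n
  ∑-lower {suc k} c h = +-mono-≤ (h zero) (∑-lower c (h ∘ suc))

∑-singletons : ∀ {n} (x : Fin n) → ∑ (λ v → bit (lookup ⁅ v ⁆ x)) ≡ 1
∑-singletons {suc n} zero    = cong suc (sum-replicate-zero n)
∑-singletons {suc n} (suc x) = cong₂ (λ b → bit b +_) (lookup-replicate x false) (∑-singletons x)

module _ {n : ℕ} where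

  -- An edge crosses only the singletons of its two ends, and a loop crosses none, hence an
  -- inequality.
  ∑-crosses : ∀ (e : Edge n) b → ∑ (λ v → bit (crosses ⁅ v ⁆ e ∧ b)) ≤ 2 * bit b
  ∑-crosses e       false = begin
    ∑ (λ v → bit (crosses ⁅ v ⁆ e ∧ false))  ≤⟨ ∑-mono {n} (λ v → ≤-reflexive (cong bit (∧-zeroʳ (crosses ⁅ v ⁆ e)))) ⟩
    ∑ {n} (λ _ → 0)                          ≡⟨ sum-replicate-zero n ⟩
    0                                        ∎
    where open ≤-Reasoning
  ∑-crosses (x , y) true  = begin
    ∑ (λ v → bit (crosses ⁅ v ⁆ (x , y) ∧ true))
      ≤⟨ ∑-mono {n} (λ v → split (lookup ⁅ v ⁆ x) (lookup ⁅ v ⁆ y)) ⟩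
    ∑ (λ v → bit (lookup ⁅ v ⁆ x) + bit (lookup ⁅ v ⁆ y))
      ≡⟨ ∑-distrib-+ {n} (λ v → bit (lookup ⁅ v ⁆ x)) _ ⟩
    ∑ (λ v → bit (lookup ⁅ v ⁆ x)) + ∑ (λ v → bit (lookup ⁅ v ⁆ y))
      ≡⟨ cong₂ _+_ (∑-singletons x) (∑-singletons y) ⟩
    2 ∎
    where
    open ≤-Reasoning
    split : ∀ p q → bit ((p xor q) ∧ true) ≤ bit p + bit q
    split true  true  = z≤n
    split true  false = ≤-refl
    split false true  = ≤-refl
    split false false = z≤n

  ∑-cut : ∀ W → ∑ (λ v → cut {n} ⁅ v ⁆ W) ≤ 2 * marked W
  ∑-cut []            = ≤-reflexive (sum-replicate-zero n)
  ∑-cut ((e , b) ∷ W) = begin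
    ∑ (λ v → bit (crosses ⁅ v ⁆ e ∧ b) + cut ⁅ v ⁆ W)
      ≡⟨ ∑-distrib-+ {n} (λ v → bit (crosses ⁅ v ⁆ e ∧ b)) _ ⟩
    ∑ (λ v → bit (crosses ⁅ v ⁆ e ∧ b)) + ∑ (λ v → cut {n} ⁅ v ⁆ W)
      ≤⟨ +-mono-≤ (∑-crosses e b) (∑-cut W) ⟩
    2 * bit b + 2 * marked W
      ≡⟨ *-distribˡ-+ 2 (bit b) (marked W) ⟨
    2 * (bit b + marked W) ∎
    where open ≤-Reasoning

-- Edge sets as marked edge lists

  marking : ∀ {m} → (Fin m → Edge n) → Subset m → List (Edge n × Bool)
  marking ends F = toList (zip (tabulate ends) F)

  marking-edges : ∀ {m} (ends : Fin m → Edge n) F → map proj₁ (marking ends F) ≡ toList (tabulate ends)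
  marking-edges ends []      = refl
  marking-edges ends (b ∷ F) = cong (ends zero ∷_) (marking-edges (ends ∘ suc) F)

  -- Reads the output of the list algorithm back as an edge set.
  marking-surjective : ∀ {m} (ends : Fin m → Edge n) W → map proj₁ W ≡ toList (tabulate ends) →
                       ∃[ F ] W ≡ marking ends F
  marking-surjective {zero}  ends []            eq = [] , refl
  marking-surjective {suc m} ends ((e , b) ∷ W) eq
    with ∷-injective eq
  ... | refl , eq′ with marking-surjective (ends ∘ suc) W eq′
  ...   | F , refl = b ∷ F , refl

  encodeMarks-marking : ∀ {m} (ends : Fin m → Edge n) F → encodeMarks (marking ends F) ≡ encodeSubset F
  encodeMarks-marking ends []      = refl
  encodeMarks-marking ends (b ∷ F) = cong (encodeBool b ∙_) (encodeMarks-marking (ends ∘ suc) F)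

  marked-marking : ∀ {m} (ends : Fin m → Edge n) F → marked (marking ends F) ≡ ∣ F ∣
  marked-marking ends []          = refl
  marked-marking ends (true  ∷ F) = cong suc (marked-marking (ends ∘ suc) F)
  marked-marking ends (false ∷ F) = marked-marking (ends ∘ suc) F

  cut-marking : ∀ {m} (ends : Fin m → Edge n) R F →
                cut R (marking ends F) ≡ ∣ tabulate (crosses R ∘ ends) ∩ F ∣
  cut-marking ends R []      = refl
  cut-marking ends R (b ∷ F) with crosses R (ends zero) ∧ b
  ... | true  = cong suc (cut-marking (ends ∘ suc) R F)
  ... | false = cut-marking (ends ∘ suc) R F

  boundary-marking : ∀ {m} (ends : Fin m → Edge n) R F →
                     boundary R (marking ends F) ≡ ∣ tabulate (crosses R ∘ ends) ∣
  boundary-marking ends R []      = refl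
  boundary-marking ends R (b ∷ F) with crosses R (ends zero)
  ... | true  = cong suc (boundary-marking (ends ∘ suc) R F)
  ... | false = boundary-marking (ends ∘ suc) R F

-- Rational arithmetic

open import Data.Integer using (+_)

fromNat : ℕ → ℚ
fromNat a = + a / 1

toℚᵘ-/ : ∀ a q .{{_ : NonZero q}} → toℚᵘ (+ a / q) ℚᵘ.≃ (+ a ℚᵘ./ q)
toℚᵘ-/ a (suc q) = ℚₚ.toℚᵘ-fromℚᵘ (mkℚᵘ (+ a) q)

≤-/-* : ∀ a b c q .{{_ : NonZero q}} → a * q ≤ c * b → fromNat a ℚ.≤ (+ c / q) ℚ.* fromNat b
≤-/-* a b c q@(suc q′) h = ℚₚ.toℚᵘ-cancel-≤ (begin
  toℚᵘ (fromNat a)                       ≃⟨ toℚᵘ-/ a 1 ⟩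
  + a ℚᵘ./ 1                             ≤⟨ *≤* (subst₂ ℤ._≤_ lhs rhs (ℤ.+≤+ h)) ⟩
  (+ c ℚᵘ./ q) ℚᵘ.* (+ b ℚᵘ./ 1)         ≃⟨ ℚᵘₚ.*-cong (toℚᵘ-/ c q) (toℚᵘ-/ b 1) ⟨
  toℚᵘ (+ c / q) ℚᵘ.* toℚᵘ (fromNat b)   ≃⟨ ℚₚ.toℚᵘ-homo-* (+ c / q) (fromNat b) ⟨
  toℚᵘ ((+ c / q) ℚ.* fromNat b)         ∎)
  where
  open ℚᵘₚ.≤-Reasoning
  lhs : + (a * q) ≡ + a ℤ.* (+ (q * 1))
  lhs = trans (cong (λ k → + (a * k)) (sym (*-identityʳ q))) (ℤₚ.pos-* a (q * 1))
  rhs : + (c * b) ≡ (+ c ℤ.* + b) ℤ.* + 1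
  rhs = trans (ℤₚ.pos-* c b) (sym (ℤₚ.*-identityʳ _))

fromNat-+ : ∀ a b → fromNat (a + b) ≡ fromNat a ℚ.+ fromNat b
fromNat-+ a b = ℚₚ.toℚᵘ-injective (begin-equality
  toℚᵘ (fromNat (a + b))                ≃⟨ toℚᵘ-/ (a + b) 1 ⟩
  + (a + b) ℚᵘ./ 1
    ≃⟨ *≡* (cong (ℤ._* + 1) (trans (ℤₚ.pos-+ a b) (sym (cong₂ ℤ._+_ (ℤₚ.*-identityʳ (+ a)) (ℤₚ.*-identityʳ (+ b)))))) ⟩
  (+ a ℚᵘ./ 1) ℚᵘ.+ (+ b ℚᵘ./ 1)        ≃⟨ ℚᵘₚ.+-cong (toℚᵘ-/ a 1) (toℚᵘ-/ b 1) ⟨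
  toℚᵘ (fromNat a) ℚᵘ.+ toℚᵘ (fromNat b) ≃⟨ ℚₚ.toℚᵘ-homo-+ (fromNat a) (fromNat b) ⟨
  toℚᵘ (fromNat a ℚ.+ fromNat b)        ∎)
  where open ℚᵘₚ.≤-Reasoning

fromNat-mono : ∀ {a b} → a ≤ b → fromNat a ℚ.≤ fromNat b
fromNat-mono {a} {b} a≤b = subst (fromNat a ℚ.≤_) (ℚₚ.*-identityˡ (fromNat b))
  (≤-/-* a b 1 1 (≤-trans (≤-reflexive (*-identityʳ a)) (≤-trans a≤b (≤-reflexive (sym (*-identityˡ b))))))

-- The sign of `x` is not given. For positive `b` the bound 0 ≤ a ≤ x b forces it to be nonnegative;
-- for `b` zero, `b′` is zero as well.
*-scale : ∀ x a b b′ → fromNat a ℚ.≤ x ℚ.* fromNat b → b ≤ b′ → (b ≡ 0 → b′ ≡ 0) →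
          x ℚ.* fromNat b ℚ.≤ x ℚ.* fromNat b′
*-scale x a zero      b′ h b≤b′ b≡0 rewrite b≡0 refl = ℚₚ.≤-refl
*-scale x a b@(suc _) b′ h b≤b′ b≡0 with 0ℚ ℚ.≤? x
... | yes 0≤x = ℚₚ.*-monoˡ-≤-nonNeg x {{ℚ.nonNegative 0≤x}} (fromNat-mono b≤b′)
... | no  0≰x = contradiction
  (ℚₚ.≤-<-trans (ℚₚ.≤-trans (fromNat-mono {0} {a} z≤n) h)
    (subst (x ℚ.* fromNat b ℚ.<_) (ℚₚ.*-zeroˡ (fromNat b))
      (ℚₚ.*-monoˡ-<-pos (fromNat b) {{ℚₚ.normalize-pos b 1}} (ℚₚ.≰⇒> 0≰x))))
  (ℚₚ.<-irrefl refl)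

-- The factor `r` is split: `r - c` pays for `a₁`, and `c`, which is 2d/q, pays for `d` forests of
-- at most `N` edges.
ratio-bound : ∀ r {a₁ b₁ a b d N q} .{{_ : NonZero q}} →
  fromNat a₁ ℚ.≤ (r ℚ.- (+ (2 * d) / q)) ℚ.* fromNat b₁ →
  b₁ ≤ b → (b₁ ≡ 0 → b ≡ 0) → a ≤ a₁ + d * N → N * q ≤ 2 * b →
  fromNat a ℚ.≤ r ℚ.* fromNat b
ratio-bound r {a₁} {b₁} {a} {b} {d} {N} {q} a₁≤ b₁≤b b₁≡0 a≤ Nq≤ = begin
  fromNat a                                    ≤⟨ fromNat-mono a≤ ⟩
  fromNat (a₁ + d * N)                         ≡⟨ fromNat-+ a₁ (d * N) ⟩
  fromNat a₁ ℚ.+ fromNat (d * N)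
    ≤⟨ ℚₚ.+-mono-≤ (ℚₚ.≤-trans a₁≤ (*-scale x a₁ b₁ b a₁≤ b₁≤b b₁≡0)) (≤-/-* (d * N) b (2 * d) q dNq≤) ⟩
  x ℚ.* fromNat b ℚ.+ c ℚ.* fromNat b          ≡⟨ ℚₚ.*-distribʳ-+ (fromNat b) x c ⟨
  (x ℚ.+ c) ℚ.* fromNat b                      ≡⟨ cong (ℚ._* fromNat b) x+c ⟩
  r ℚ.* fromNat b                              ∎
  where
  open ℚₚ.≤-Reasoning
  c = + (2 * d) / q
  x = r ℚ.- c
  x+c : x ℚ.+ c ≡ r
  x+c = trans (ℚₚ.+-assoc r (ℚ.- c) c) (trans (cong (r ℚ.+_) (ℚₚ.+-inverseˡ c)) (ℚₚ.+-identityʳ r))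
  dNq≤ : d * N * q ≤ 2 * d * b
  dNq≤ = ≤-trans (≤-reflexive (*-assoc d N q)) (≤-trans (*-monoʳ-≤ d Nq≤)
    (≤-reflexive (trans (sym (*-assoc d 2 b)) (cong (_* b) (*-comm d 2)))))

-- The capped number of rounds

∸-⊓ : ∀ a b m → (a ⊓ m) ∸ (b ⊓ m) ≡ (a ⊓ m) ∸ b
∸-⊓ a b m with ≤-total b m
... | inj₁ b≤m = cong (a ⊓ m ∸_) (m≤n⇒m⊓n≡m b≤m)
... | inj₂ m≤b = trans (cong (a ⊓ m ∸_) (m≥n⇒m⊓n≡n m≤b))
  (trans (m≤n⇒m∸n≡0 (m⊓n≤n a m)) (sym (m≤n⇒m∸n≡0 (≤-trans (m⊓n≤n a m) m≤b))))

digits-fromℕ : ∀ q m → digits (ℕᵇ.fromℕ q) m 1 0 ⊓ m ≡ q ⊓ m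
digits-fromℕ q m = trans (digits-⊓ (ℕᵇ.fromℕ q) m 1 0)
  (cong (_⊓ m) (trans (*-identityʳ _) (ℕᵇₚ.toℕ-fromℕ q)))

-- The program subtracts an uncapped numeral. As the minuend is at most `m`, only the capped value
-- of that numeral matters, and this one is correct.
rounds-correct : ∀ p q m → (digits (ℕᵇ.fromℕ q) m 1 0 ⊓ m) ∸ digits (ℕᵇ.fromℕ p) m 1 0 ≡ (q ⊓ m) ∸ p
rounds-correct p q m = begin
  (q′ ⊓ m) ∸ p′        ≡⟨ ∸-⊓ q′ p′ m ⟨
  (q′ ⊓ m) ∸ (p′ ⊓ m)  ≡⟨ cong₂ _∸_ (digits-fromℕ q m) (digits-fromℕ p m) ⟩
  (q ⊓ m) ∸ (p ⊓ m)    ≡⟨ ∸-⊓ q p m ⟩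
  (q ⊓ m) ∸ p          ∎
  where
  open ≡-Reasoning
  q′ = digits (ℕᵇ.fromℕ q) m 1 0
  p′ = digits (ℕᵇ.fromℕ p) m 1 0

-- `P` need not be decidable, so descent on cardinality yields a minimum only up to double negation.
-- This suffices for proving decidable inequalities.
¬¬-minimum : ∀ {m} (P : Subset m → Set) F → P F → ¬ ¬ (∃[ F₀ ] P F₀ × ∀ F′ → P F′ → ∣ F₀ ∣ ≤ ∣ F′ ∣)
¬¬-minimum P F PF none = search (suc ∣ F ∣) F ≤-refl PF
  where
  search : ∀ k F → ∣ F ∣ < k → ¬ P F
  search (suc k) F (s≤s F≤k) PF = none (F , PF , λ F′ PF′ →
    decidable-stable (∣ F ∣ ≤? ∣ F′ ∣) λ F≰F′ → search k F′ (≤-trans (≰⇒> F≰F′) F≤k) PF′)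

encodeFamily-edges : ∀ {n m} (ends : Fin m → Edge n) →
  encodeFamily (encodeEdge ∘ ends) ≡ encodeList (map encodeEdge (toList (tabulate ends)))
encodeFamily-edges {m = zero}  ends = refl
encodeFamily-edges {m = suc m} ends = cong (encodeEdge (ends zero) ∙_) (encodeFamily-edges (ends ∘ suc))

select-nth : ∀ j p (f : Fin (suc j) → Tree) x → select p x ≡ encodeFamily f →
             select (nth p j) x ≡ f (Fin.fromℕ j)
select-nth zero    p f x eq = cong head eq
select-nth (suc j) p f x eq = select-nth j (tl p) (f ∘ suc) x (cong tail eq)

encodeℕ-nonZero : ∀ q .{{_ : NonZero q}} → ∃[ s ] ∃[ t ] encodeℕ q ≡ s ∙ t
encodeℕ-nonZero (suc q) with ℕᵇ.fromℕ (suc q) in eq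
... | ℕᵇ.2[1+ x ] = _ , _ , refl
... | ℕᵇ.1+[2 x ] = _ , _ , refl
... | ℕᵇ.zero with trans (sym (ℕᵇₚ.toℕ-fromℕ (suc q))) (cong ℕᵇ.toℕ eq)
...   | ()

-- Size of edge-connected sets

module _ (G : Graph) where
  open Graph G

  singleton-cut : 2 ≤ n → ∀ v → IsCut ⁅ v ⁆
  singleton-cut 2≤n v = (v , x∈⁅x⁆ v) , (λ _ → ∈⊤) , other 2≤n v
    where
    other : ∀ {n} → 2 ≤ n → (v : Fin n) → ∃[ x ] x ∈ ⊤ × ¬ (x ∈ ⁅ v ⁆)
    other (s≤s (s≤s _)) zero    = suc zero , ∈⊤ , λ x∈ → contradiction (x∈⁅y⁆⇒x≡y zero x∈) λ ()
    other (s≤s (s≤s _)) (suc v) = zero , ∈⊤ , λ x∈ → contradiction (x∈⁅y⁆⇒x≡y (suc v) x∈) λ ()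

  -- Every vertex has degree at least `q`, and degrees sum to at most 2|F|. With fewer than two
  -- vertices no singleton is a cut, but then `n ∸ 1` vanishes.
  edge-connected-size : ∀ q F → EdgeConnected G q F → (n ∸ 1) * q ≤ 2 * ∣ F ∣
  edge-connected-size q F conn with 2 ≤? n
  ... | no 2≰n = ≤-trans (≤-reflexive (cong (_* q) (m≤n⇒m∸n≡0 (≤-pred (≰⇒> 2≰n))))) z≤n
  ... | yes 2≤n = begin
    (n ∸ 1) * q                              ≤⟨ *-monoˡ-≤ q (m∸n≤m n 1) ⟩
    n * q                                    ≤⟨ ∑-lower {n} q (λ v → ≤-trans (conn ⁅ v ⁆ (singleton-cut 2≤n v))
                                                  (≤-reflexive (sym (cut-marking ends ⁅ v ⁆ F)))) ⟩
    _                                        ≤⟨ ∑-cut (marking ends F) ⟩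
    2 * marked (marking ends F)              ≡⟨ cong (2 *_) (marked-marking ends F) ⟩
    2 * ∣ F ∣                                ∎
    where open ≤-Reasoning

-- The reduction

-- A is called on the graph and q₁, which is positive precisely when its
-- encoding is not nil.
`solve : Program → Term → Program
`solve A t = `if (fetch q₁-selector)
  (`pair `id (`pair (fetch (hd whole)) (fetch q₁-selector) ⨾ A) ⨾ compile t)
  -- For q₁ = 0 there is no ECSS instance on which `A` is known to halt; stopping at once keeps the
  -- time bound valid on all instances.
  `nil

solve-run : ∀ A t x {u v y s} → select q₁-selector x ≡ u ∙ v →
            A ⊢ head x ∙ select q₁-selector x ⇓ y [ s ] →
            RunsWithin (`solve A t) x (⟦ t ⟧ x y) (23 + (s + time t (size x)))
solve-run A t x {y = y} {s} q₁-eq A⇓ with compile-run t x y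
... | a , t⇓ , a≤ = _
  , ⇓then (subst (_ ⊢ x ⇓_[ _ ]) q₁-eq (fetch-run q₁-selector x))
      (⇓seq (⇓pair ⇓id (⇓seq (⇓pair (fetch-run (hd whole) x) (fetch-run q₁-selector x)) A⇓)) t⇓)
  , +-monoʳ-≤ 23 (+-monoʳ-≤ s a≤)

solve-reject : ∀ A t x → select q₁-selector x ≡ nil → `solve A t ⊢ x ⇓ nil [ 9 ]
solve-reject A t x q₁-eq = ⇓else (subst (_ ⊢ x ⇓_[ _ ]) q₁-eq (fetch-run q₁-selector x)) ⇓nil

module Reduction {κ : GraphKind} {k : ℕ} (I : FGCInstance κ (suc k)) where
  open FGCInstance I
  open Graph G using (n; m; ends)
  open Problem (FGC κ (suc k)) using (encode; FeasibleInstance)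

  ecss : .{{NonZero q₁}} → ECSSInstance κ
  ecss = record { G = G ; kind = kind ; p = q₁ }

  L : List (Edge n)
  L = toList (tabulate ends)

  qs : Fin (suc k) → Tree
  qs i = encodeℕ (q i)

  requirements : Tree
  requirements = encodeFamily (λ i → encodeSubset (T i)) ∙ encodeFamily qs

  encode-input : encode I ≡ Semantics.input L requirements
  encode-input = cong (λ E → (encodeUnary n ∙ E) ∙ requirements) (encodeFamily-edges ends)

  size-ecss : .{{_ : NonZero q₁}} → size (Problem.encode (ECSS κ) ecss) ≤ size (encode I)
  size-ecss = s≤s (+-monoʳ-≤ (size (encodeGraph G)) (size-select (hd (tl whole)) requirements))

  -- Whichever tier makes a cut safe demands at least q₁ edges. Hence the ECSS optimum is at most
  -- the FGC optimum.
  IsFGC⇒EdgeConnected : ∀ F → IsFGC F → EdgeConnected G q₁ F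
  IsFGC⇒EdgeConnected F fgc R R-cut with fgc R R-cut
  ... | i , safe = begin
    q₁                   ≤⟨ q-mono z≤n ⟩
    q i                  ≤⟨ safe ⟩
    ∣ δ R ∩ F ∩ T i ∣    ≤⟨ p⊆q⇒∣p∣≤∣q∣ {p = δ R ∩ F ∩ T i} {δ R ∩ F} sub ⟩
    ∣ δ R ∩ F ∣          ∎
    where
    open ≤-Reasoning
    sub : δ R ∩ F ∩ T i ⊆ δ R ∩ F
    sub x∈ with x∈p∩q⁻ (δ R) (F ∩ T i) x∈
    ... | x∈δ , x∈F∩T = x∈p∩q⁺ (x∈δ , proj₁ (x∈p∩q⁻ F (T i) x∈F∩T))

  rounds : ℕ
  rounds = (qₖ ⊓ m) ∸ q₁

  module _ (F₁ : EdgeSet) where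

    W : List (Edge n × Bool)
    W = augments rounds (marking ends F₁)

    private
      surjective : ∃[ F ] W ≡ marking ends F
      surjective = marking-surjective ends W
        (trans (augments-edges rounds (marking ends F₁)) (marking-edges ends F₁))

    result : EdgeSet
    result = proj₁ surjective

    W-result : W ≡ marking ends result
    W-result = proj₂ surjective

    main-result : ⟦ `main k ⟧ (encode I) (encodeSubset F₁) ≡ encodeSubset result
    main-result = begin
      ⟦ `main k ⟧ (encode I) (encodeSubset F₁)
        ≡⟨ cong₂ ⟦ `main k ⟧ encode-input (sym (encodeMarks-marking ends F₁)) ⟩
      ⟦ `main k ⟧ (Semantics.input L requirements) (encodeMarks (marking ends F₁))
        ≡⟨ Semantics.⟦main⟧ L requirements k (ℕᵇ.fromℕ q₁) (ℕᵇ.fromℕ qₖ) refl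
             (select-nth k (tl (tl whole)) qs (Semantics.input L requirements) refl)
             (marking ends F₁) (marking-edges ends F₁) ⟩
      encodeMarks (schedule (length L) p′ q′ (marking ends F₁))
        ≡⟨ cong encodeMarks (schedule-augments (length L) p′ q′ (marking ends F₁)) ⟩
      encodeMarks (augments ((q′ ⊓ length L) ∸ p′) (marking ends F₁))
        ≡⟨ cong (λ j → encodeMarks (augments j (marking ends F₁))) (trans (rounds-correct q₁ qₖ (length L))
             (cong (λ l → (qₖ ⊓ l) ∸ q₁) (length-toList (tabulate ends)))) ⟩
      encodeMarks W
        ≡⟨ cong encodeMarks W-result ⟩
      encodeMarks (marking ends result)
        ≡⟨ encodeMarks-marking ends result ⟩
      encodeSubset result ∎
      where
      open ≡-Reasoning
      p′ = digits (ℕᵇ.fromℕ q₁) (length L) 1 0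
      q′ = digits (ℕᵇ.fromℕ qₖ) (length L) 1 0

    result-size : ∣ result ∣ ≤ ∣ F₁ ∣ + (qₖ ∸ q₁) * (n ∸ 1)
    result-size = begin
      ∣ result ∣                                      ≡⟨ marked-marking ends result ⟨
      marked (marking ends result)                    ≡⟨ cong marked W-result ⟨
      marked W                                        ≤⟨ augments-marked rounds (marking ends F₁) ⟩
      marked (marking ends F₁) + rounds * (n ∸ 1)     ≡⟨ cong (_+ rounds * (n ∸ 1)) (marked-marking ends F₁) ⟩
      ∣ F₁ ∣ + rounds * (n ∸ 1)                       ≤⟨ +-monoʳ-≤ ∣ F₁ ∣ (*-monoˡ-≤ (n ∸ 1) (∸-monoˡ-≤ q₁ (m⊓n≤m qₖ m))) ⟩
      ∣ F₁ ∣ + (qₖ ∸ q₁) * (n ∸ 1)                    ∎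
      where open ≤-Reasoning

    result-cut : EdgeConnected G q₁ F₁ → ∀ R → IsCut R → ∣ δ R ∣ ⊓ qₖ ≤ ∣ δ R ∩ result ∣
    result-cut conn R R-cut = begin
      ∣ δ R ∣ ⊓ qₖ
        -- As |δ(R)| ≤ m, the cap on `rounds` is harmless: the minimum is at most `qₖ ⊓ m`, which is
        -- at most `q₁ + rounds`.
        ≤⟨ ⊓-glb (m⊓n≤m ∣ δ R ∣ qₖ) (≤-trans
             (⊓-glb (m⊓n≤n ∣ δ R ∣ qₖ) (≤-trans (m⊓n≤m ∣ δ R ∣ qₖ) (∣p∣≤n (δ R))))
             (m≤n+m∸n (qₖ ⊓ m) q₁)) ⟩
      ∣ δ R ∣ ⊓ (q₁ + rounds)
        ≤⟨ ⊓-monoʳ-≤ ∣ δ R ∣ (≤-trans (+-monoˡ-≤ rounds (conn R R-cut))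
             (≤-reflexive (+-comm ∣ δ R ∩ F₁ ∣ rounds))) ⟩
      ∣ δ R ∣ ⊓ (rounds + ∣ δ R ∩ F₁ ∣)
        ≡⟨ cong₂ (λ b c → b ⊓ (rounds + c)) (boundary-marking ends R F₁) (cut-marking ends R F₁) ⟨
      boundary R (marking ends F₁) ⊓ (rounds + cut R (marking ends F₁))
        ≤⟨ augments-cut R rounds (marking ends F₁) ⟩
      cut R W
        ≡⟨ cong (cut R) W-result ⟩
      cut R (marking ends result)
        ≡⟨ cut-marking ends R result ⟩
      ∣ δ R ∩ result ∣ ∎
      where open ≤-Reasoning

    result-feasible : FeasibleInstance I → EdgeConnected G q₁ F₁ → IsFGC result
    result-feasible feasible conn R R-cut with Finₚ.any? (λ x → (x ∈? δ R) ×-dec ¬? (x ∈? result))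
    ... | no none with feasible R R-cut
    ...   | i , safe = i , ≤-trans safe (p⊆q⇒∣p∣≤∣q∣ {p = δ R ∩ ⊤ ∩ T i} {δ R ∩ result ∩ T i} sub)
      where
      δ⊆ : δ R ⊆ result
      δ⊆ {x} x∈δ = decidable-stable (x ∈? result) λ x∉ → none (x , x∈δ , x∉)
      sub : δ R ∩ ⊤ ∩ T i ⊆ δ R ∩ result ∩ T i
      sub x∈ with x∈p∩q⁻ (δ R) (⊤ ∩ T i) x∈
      ... | x∈δ , x∈⊤∩T = x∈p∩q⁺ (x∈δ , x∈p∩q⁺ (δ⊆ x∈δ , proj₂ (x∈p∩q⁻ ⊤ (T i) x∈⊤∩T)))
    result-feasible feasible conn R R-cut | yes (x , x∈δ , x∉result) = lastTier , (begin
      qₖ                                  ≤⟨ large ⟩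
      ∣ δ R ∩ result ∣                    ≡⟨ cong (λ S → ∣ δ R ∩ S ∣) (∩-identityʳ result) ⟨
      ∣ δ R ∩ result ∩ ⊤ ∣                ≡⟨ cong (λ S → ∣ δ R ∩ result ∩ S ∣) T-last ⟨
      ∣ δ R ∩ result ∩ T lastTier ∣       ∎)
      where
      open ≤-Reasoning
      large : qₖ ≤ ∣ δ R ∩ result ∣
      large with ≤-total qₖ ∣ δ R ∣
      ... | inj₁ qₖ≤δ = ≤-trans (≤-reflexive (sym (m≥n⇒m⊓n≡n qₖ≤δ))) (result-cut conn R R-cut)
      -- Here `result-cut` would put all of δ(R) into the result, but `x` is missing.
      ... | inj₂ δ≤qₖ = contradiction
        (≤-trans (≤-reflexive (sym (m≤n⇒m⊓n≡m δ≤qₖ))) (result-cut conn R R-cut))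
        (<⇒≱ (p⊂q⇒∣p∣<∣q∣ {p = δ R ∩ result} {δ R}
          (p∩q⊆p (δ R) result , x , x∈δ , x∉result ∘ proj₂ ∘ x∈p∩q⁻ (δ R) result)))

  -- The guarantee of `A` refers to a minimum ECSS solution, available only under double negation;
  -- the comparison of rationals to be shown is decidable and hence stable.
  ratio : (α : ℕ → ℝ) .{{_ : NonZero q₁}} → ∀ F₁ →
          (∀ F₀ → Problem.IsMinimum (ECSS κ) ecss F₀ → ∣ F₁ ∣ ≤ α q₁ · ∣ F₀ ∣) →
          ∀ F* → Problem.IsMinimum (FGC κ (suc k)) I F* →
          ∣ result F₁ ∣ ≤ α q₁ ⊕ (+ (2 * (qₖ ∸ q₁)) / q₁) · ∣ F* ∣
  ratio α F₁ approx F* (F*-feasible , F*-min) r r-upper =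
    decidable-stable (fromNat ∣ result F₁ ∣ ℚ.≤? r ℚ.* fromNat ∣ F* ∣) λ not-within →
      ¬¬-minimum (EdgeConnected G q₁) F* F*-connected λ where
        (F₀ , F₀-connected , F₀-min) → not-within
          (ratio-bound r {b = ∣ F* ∣} {d = qₖ ∸ q₁} {N = n ∸ 1}
            -- By definition of `⊕`, `r-upper` says that `r` minus the added term lies in the upper
            -- cut of `α q₁`.
            (approx F₀ (F₀-connected , F₀-min) _ r-upper)
            (F₀-min F* F*-connected)
            (λ F₀≡0 → n≤0⇒n≡0 (≤-trans (F*-min F₀ (no-cuts F₀ F₀-connected F₀≡0)) (≤-reflexive F₀≡0)))
            (result-size F₁)
            (edge-connected-size G q₁ F* F*-connected))
    where
    F*-connected : EdgeConnected G q₁ F*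
    F*-connected = IsFGC⇒EdgeConnected F* F*-feasible
    -- As q₁ is positive, an empty connected solution means that there are no cuts at all. It is
    -- then FGC-feasible too, and the FGC optimum is 0, as `ratio-bound` demands.
    no-cuts : ∀ F₀ → EdgeConnected G q₁ F₀ → ∣ F₀ ∣ ≡ 0 → IsFGC F₀
    no-cuts F₀ conn F₀≡0 R R-cut = contradiction
      (≤-trans (>-nonZero⁻¹ q₁) (≤-trans (conn R R-cut) (∣p∩q∣≤∣q∣ (δ R) F₀)))
      (<⇒≱ (s≤s (≤-reflexive F₀≡0)))

-- Running time and guarantee of the whole program

substitute-bound : ∀ {a s k M N} c d τ → a ≤ k + (s + τ) → s ≤ c * M ^ d → M ≤ N → a ≤ k + (c * N ^ d + τ)
substitute-bound {k = k} c d τ a≤ s≤ M≤N =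
  ≤-trans a≤ (+-monoʳ-≤ k (+-monoˡ-≤ τ (≤-trans s≤ (*-monoʳ-≤ c (^-monoˡ-≤ d M≤N)))))

module _ {κ : GraphKind} (k : ℕ) (A : Program) where

  open Problem (FGC κ (suc k)) using (encode)

  solve-terminates : ∀ t I c d →
    (∀ J → ∃[ y ] RunsWithin A (Problem.encode (ECSS κ) J) y (c * size (Problem.encode (ECSS κ) J) ^ d)) →
    ∃[ y ] RunsWithin (`solve A t) (encode I) y (23 + (c * size (encode I) ^ d + time t (size (encode I))))
  solve-terminates t I c d A-run with FGCInstance.q₁ I ≟ 0
  ... | yes q₁≡0 = nil , 9 , solve-reject A t (encode I) (cong encodeℕ q₁≡0)
    , m≤m+n 9 (14 + (c * size (encode I) ^ d + time t (size (encode I))))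
  ... | no q₁≢0
    with A-run (Reduction.ecss I {{≢-nonZero q₁≢0}}) | encodeℕ-nonZero (FGCInstance.q₁ I) {{≢-nonZero q₁≢0}}
  ...   | y , s , A⇓ , s≤ | _ , _ , q₁-eq with solve-run A t (encode I) q₁-eq A⇓
  ...     | a , ⇓y , a≤ = _ , a , ⇓y
    , substitute-bound {k = 23} c d (time t (size (encode I))) a≤ s≤ (Reduction.size-ecss I {{≢-nonZero q₁≢0}})

  solve-polynomial : ∀ t → Problem.PolynomialTime (ECSS κ) A → Problem.PolynomialTime (FGC κ (suc k)) (`solve A t)
  solve-polynomial t (c , d , A-run) = c′ , d′ , λ I →
    let y , s , ⇓y , s≤ = solve-terminates t I c d A-run in
    y , s , ⇓y , ≤-trans s≤ (bound (size (encode I)) {{size-nonZero (encode I)}})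
    where
    polynomial : Polynomial λ N → 23 + (c * N ^ d + time t N)
    polynomial = +-polynomial (const-polynomial 23) (+-polynomial (c , d , λ _ → ≤-refl) (time-polynomial t))
    c′ = proj₁ polynomial
    d′ = proj₁ (proj₂ polynomial)
    bound : ∀ N .{{_ : NonZero N}} → 23 + (c * N ^ d + time t N) ≤ c′ * N ^ d′
    bound = proj₂ (proj₂ polynomial)

  solve-approximates : ∀ (α : ℕ → ℝ) t →
    (∀ I F₁ → ⟦ t ⟧ (Problem.encode (FGC κ (suc k)) I) (encodeSubset F₁) ≡ encodeSubset (Reduction.result I F₁)) →
    ApproximatesECSS κ α A →
    ApproximatesFGC κ (suc k) (λ q₁ qₖ → α q₁ ⊕ (+ (2 * (qₖ ∸ q₁)) / q₁)) (`solve A t)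
  solve-approximates α t t-result (A-polynomial , A-approximates) =
    solve-polynomial t A-polynomial , returns
    where
    open Problem (FGC κ (suc k)) using (FeasibleInstance; ReturnsWithin)
    open FGCInstance using (q₁; qₖ)
    returns : ∀ I → .{{_ : NonZero (q₁ I)}} → FeasibleInstance I →
              ReturnsWithin (`solve A t) I (α (q₁ I) ⊕ (+ (2 * (qₖ I ∸ q₁ I)) / q₁ I))
    returns I feasible
      with A-approximates (Reduction.ecss I) (Reduction.IsFGC⇒EdgeConnected I ⊤ feasible)
         | encodeℕ-nonZero (q₁ I)
    ... | F₁ , _ , A⇓ , connected , approx | _ , _ , q₁-eq
      with solve-run A t (encode I) q₁-eq A⇓
    ...   | s , ⇓y , _ =
      Reduction.result I F₁ , s
      , subst (`solve A t ⊢ encode I ⇓_[ s ]) (t-result I F₁) ⇓y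
      , Reduction.result-feasible I F₁ feasible connected
      , Reduction.ratio I α F₁ approx

theorem1p2 : (κ : GraphKind) (α : ℕ → ℝ) →
    (∃[ A ] ApproximatesECSS κ α A) →
    (k : ℕ) .{{_ : NonZero k}} →
    ∃[ B ] ApproximatesFGC κ k (λ q₁ qₖ → α q₁ ⊕ (+ (2 * (qₖ ∸ q₁)) / q₁)) B
theorem1p2 κ α (A , A-approximates) (suc k) =
  `solve A (`main k) , solve-approximates k A α (`main k) Reduction.main-result A-approximates
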